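{- Let $\mathcal{R}$ be a finite valuation ring of order $q^r$, where $q$ is a power of an odd prime. For every constant $c>0$ there is a constant $C>0$ depending only on $c$ such that: for every $\mathcal{A}\subset\mathcal{R}$ with $|\mathcal{A}|\ge 2q^{r-1}$ and $|\mathcal{A}+\mathcal{A}|\,|\mathcal{A}|^2\ge c\,q^{3r-1}$, \[\max\{|\mathcal{A}+\mathcal{A}|,\ |\mathcal{A}^2+\mathcal{A}^2|\}\ \ge\ C\,q^{r/3}|\mathcal{A}|^{2/3}.\]
   Context: A finite valuation ring is a finite, local, principal commutative ring with identity. Its unique maximal ideal is $(z)$ for a uniformizer $z$; the residue field $\mathcal{R}/(z)$ has $q$ elements; $r$ is the smallest positive integer with $z^r=0$; then $|\mathcal{R}|=q^r$ and $|(z)|=q^{r-1}$. For $\mathcal{A}\subset\mathcal{R}$: $\mathcal{A}+\mathcal{A}=\{a+b: a,b\in\mathcal{A}\}$, $\mathcal{A}^2=\{x^2: x\in\mathcal{A}\}$, and $\mathcal{A}^2+\mathcal{A}^2=\{u+v: u,v\in\mathcal{A}^2\}$. -}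

module Defs where

open import Algebra.Bundles using (CommutativeRing)
import Algebra.Properties.AbelianGroup as AbelianGroupProperties
import Algebra.Properties.Ring as RingProperties
import Algebra.Properties.Semiring.Divisibility as Divisibility
import Algebra.Properties.Semiring.Exp as Exp
open import Data.Fin.Base using (Fin)
open import Data.Fin.Properties using (_≟_; any?)
import Data.Fin.Subset as Subset
open import Data.Fin.Subset using (Subset)
open import Data.Fin.Subset.Properties using (_∈?_)
open import Data.Integer.Base using (+_)
open import Data.Nat.Base as ℕ using (ℕ)
open import Data.Nat.Primality using (Prime)
open import Data.Product.Base using (∃-syntax; _×_)
open import Data.Rational.Base as ℚ using (ℚ)
open import Data.Sum.Base using (_⊎_)
open import Data.Vec.Base using (tabulate)
open import Function.Base using (_∘_)
open import Function.Bundles using (Inverse; _⇔_)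
open import Level using (Level; _⊔_; suc)
open import Relation.Binary.Bundles using (Setoid)
open import Relation.Binary.PropositionalEquality.Core using (_≡_; _≢_)
import Relation.Binary.PropositionalEquality.Properties as ≡
import Relation.Binary.Reasoning.Setoid as SetoidReasoning
open import Relation.Nullary.Decidable.Core using (does; _×-dec_)
open import Relation.Unary using (Pred; Decidable)

HasSize : ∀ {a ℓ} → Setoid a ℓ → ℕ → Set (a ⊔ ℓ)
HasSize S n = Inverse S (≡.setoid (Fin n))

-- A subset of a ring with n elements (up to ≈) is a `Subset n`, read through
-- a fixed enumeration of the ring.  Every set of ring elements is of this form
-- classically; in particular `IsIdeal` below ranges over all decidable ideals.

module FiniteRing {a ℓ} (R : CommutativeRing a ℓ) {n : ℕ}
                  (size : HasSize (CommutativeRing.setoid R) n) where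

  open CommutativeRing R
  open Divisibility semiring using (_∣_)
  open Inverse size using () renaming (to to index; from to element)

  infix 4 _∈_

  _∈_ : Carrier → Subset n → Set
  x ∈ A = index x Subset.∈ A

  record IsIdeal (I : Subset n) : Set a where
    field
      0∈       : 0# ∈ I
      +-closed : ∀ {x y} → x ∈ I → y ∈ I → x + y ∈ I
      *-closed : ∀ x {y} → y ∈ I → x * y ∈ I

  IsGeneratedBy : Subset n → Carrier → Set (a ⊔ ℓ)
  IsGeneratedBy I g = ∀ x → x ∈ I ⇔ g ∣ x

  IsPrincipal : Set (a ⊔ ℓ)
  IsPrincipal = ∀ I → IsIdeal I → ∃[ g ] IsGeneratedBy I g

  record IsMaximalIdeal (M : Subset n) : Set a where
    field
      isIdeal : IsIdeal M
      proper  : M ≢ Subset.⊤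
      maximal : ∀ I → IsIdeal I → M Subset.⊆ I → I ≡ M ⊎ I ≡ Subset.⊤

  IsLocal : Set a
  IsLocal = ∃[ M ] IsMaximalIdeal M × (∀ M′ → IsMaximalIdeal M′ → M′ ≡ M)

  comprehension : ∀ {p} {P : Pred (Fin n) p} → Decidable P → Subset n
  comprehension P? = tabulate (does ∘ P?)

  infixl 6 _⊕_

  _⊕_ : Subset n → Subset n → Subset n
  A ⊕ B = comprehension λ k → any? λ i → any? λ j →
    i ∈? A ×-dec j ∈? B ×-dec k ≟ index (element i + element j)

  squares : Subset n → Subset n
  squares A = comprehension λ k → any? λ i →
    i ∈? A ×-dec k ≟ index (element i * element i)

record FiniteValuationRing (a ℓ : Level) : Set (suc (a ⊔ ℓ)) where
  field
    commutativeRing : CommutativeRing a ℓ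
    order           : ℕ
    size            : HasSize (CommutativeRing.setoid commutativeRing) order

  open CommutativeRing commutativeRing public using (Carrier)
  open CommutativeRing commutativeRing hiding (Carrier)
  open FiniteRing commutativeRing size public
  open Divisibility semiring using (_∣_; _,_; xy≈z⇒y∣z; ∣-respʳ; x∣ʳy⇒x∣ʳzy; _∣0)
  open Exp semiring using (_^_)

  field
    isLocal     : IsLocal
    isPrincipal : IsPrincipal

  IsUniformizer : Carrier → Set (a ⊔ ℓ)
  IsUniformizer z = ∃[ M ] IsMaximalIdeal M × IsGeneratedBy M z

  record IsNilpotencyIndex (z : Carrier) (r : ℕ) : Set ℓ where
    field
      positive : 0 ℕ.< r
      vanishes : z ^ r ≈ 0#
      least    : ∀ s → 0 ℕ.< s → z ^ s ≈ 0# → r ℕ.≤ s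

  residueField : Carrier → Setoid a (a ⊔ ℓ)
  residueField z = record
    { Carrier       = Carrier
    ; _≈_           = λ x y → z ∣ x - y
    ; isEquivalence = record
      { refl  = λ {x} → ∣-respʳ (sym (-‿inverseʳ x)) (z ∣0)
      ; sym   = λ {x} {y} z∣x-y → ∣-respʳ (-1*[x-y]≈y-x x y) (x∣ʳy⇒x∣ʳzy (- 1#) z∣x-y)
      ; trans = λ {x} {y} {w} z∣x-y z∣y-w → ∣-respʳ ([x-y]+[y-w]≈x-w x y w) (∣-+ z∣x-y z∣y-w)
      }
    }
    where
    open AbelianGroupProperties +-abelianGroup using (⁻¹-anti-homo‿-)
    open RingProperties ring using (-1*x≈-x)
    open SetoidReasoning setoid

    ∣-+ : ∀ {x y} → z ∣ x → z ∣ y → z ∣ x + y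
    ∣-+ (p , pz≈x) (q , qz≈y) = xy≈z⇒y∣z (p + q) z (trans (distribʳ z p q) (+-cong pz≈x qz≈y))

    -1*[x-y]≈y-x : ∀ x y → - 1# * (x - y) ≈ y - x
    -1*[x-y]≈y-x x y = begin
      - 1# * (x - y)  ≈⟨ -1*x≈-x (x - y) ⟩
      - (x - y)       ≈⟨ ⁻¹-anti-homo‿- x y ⟩
      y - x           ∎

    [x-y]+[y-w]≈x-w : ∀ x y w → (x - y) + (y - w) ≈ x - w
    [x-y]+[y-w]≈x-w x y w = begin
      (x - y) + (y - w)      ≈⟨ +-assoc x (- y) (y - w) ⟩
      x + (- y + (y - w))    ≈⟨ +-congˡ (+-assoc (- y) y (- w)) ⟨
      x + ((- y + y) - w)    ≈⟨ +-congˡ (+-congʳ (-‿inverseˡ y)) ⟩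
      x + (0# - w)           ≈⟨ +-congˡ (+-identityˡ (- w)) ⟩
      x - w                  ∎

OddPrimePower : ℕ → Set
OddPrimePower q = ∃[ p ] ∃[ k ] Prime p × p ≢ 2 × 0 ℕ.< k × q ≡ p ℕ.^ k

fromℕ : ℕ → ℚ
fromℕ n = + n ℚ./ 1

-- `C · n ^⅓≤ m` is the real inequality C n^{1/3} ≤ m, cubed so that it can be
-- stated in ℚ; it is used with n = q^r |A|², so that n^{1/3} = q^{r/3} |A|^{2/3}.
-- Constants may be taken rational: shrinking a real c > 0 to a smaller rational
-- weakens the hypothesis it occurs in, and shrinking C weakens the conclusion.
_·_^⅓≤_ : ℚ → ℕ → ℕ → Set
C · n ^⅓≤ m = C ℚ.* C ℚ.* C ℚ.* fromℕ n ℚ.≤ fromℕ (m ℕ.^ 3)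

{-# OPTIONS --safe #-}
-- Let S = A + A, U = A² and T = U + U.  For a ∈ A and u ∈ U, the equation
-- (s − a)² + u = t has at least |A| solutions (s , t) ∈ S × T, namely s = a + b,
-- t = b² + u for b ∈ A.  Over all (a , u) ∈ R² the number of solutions has mean
-- P / |R|, where P = |S||T|, and the sum of its squares is at most
-- P² + |R||(z)|P: writing a second solution as s + δ, the difference of the two
-- left-hand sides is affine in a with slope −2δ, hence equidistributed unless
-- δ ∈ (z).  By Cauchy–Schwarz, either |R||A| ≤ 2P or |A|³|U| ≤ 4|R||(z)|P.  Since
-- a unit has the same square as at most one other element, |A| ≤ 4|U|, and both
-- cases give the bound, the second one through the hypothesis on |A + A||A|².
-- Expanding elements in base z yields |R| = q^r and |(z)| ≤ q^(r−1).
module Submission where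

open import Defs
open import Algebra.Bundles using (CommutativeRing)
open import Algebra.Core using (Op₁; Op₂)
import Algebra.Morphism.RingMonomorphism as RingMonomorphism
open import Algebra.Morphism.Structures using (IsRingMonomorphism)
import Algebra.Properties.Ring as RingProperties
import Algebra.Properties.Semiring.Divisibility as Divisibility
import Algebra.Properties.Semiring.Exp as Exp
import Algebra.Solver.Ring.NaturalCoefficients.Default as SemiringSolver
open import Algebra.Structures using (IsCommutativeRing)
open import Data.Bool.Base using (if_then_else_; true)
open import Data.Fin.Base using (Fin; zero; suc; combine; remQuot)
open import Data.Fin.Permutation using (permutation)
open import Data.Fin.Properties
  using (_≟_; _<?_; <-cmp; any?; combine-remQuot; injective⇒≤; remQuot-combine)
open import Data.Fin.Subset using (Subset; ∣_∣; inside; outside; _∈_; _∉_; ⊤)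
open import Data.Fin.Subset.Properties
  using (_∈?_; ∈⊤; ⊆⊤; ⊆-antisym; nonempty?; Empty-unique; ∣⊥∣≡0; ∣p∣≤n)
import Data.Integer.Base as ℤ
import Data.Integer.Properties as ℤ
open import Data.Nat.Base
  using (ℕ; zero; suc; _+_; _*_; _∸_; _^_; _⊔_; _≤_; _≥_; _<_; z≤n; s≤s; NonZero; >-nonZero; >-nonZero⁻¹)
open import Data.Nat.Divisibility using (divides; ∣1⇒≡1) renaming (_∣_ to _∣ℕ_)
open import Data.Nat.Primality using (prime[2]; euclidsLemma; prime⇒irreducible; prime⇒nonZero)
import Data.Nat.Properties as ℕ
open import Data.Nat.Tactic.RingSolver using (solve-∀)
open import Data.Product.Base using (∃-syntax; _×_; _,_; proj₁; proj₂)
open import Data.Rational.Base as ℚ using (ℚ; 0ℚ; 1ℚ; ½)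
import Data.Rational.Properties as ℚ
import Data.Rational.Unnormalised.Base as ℚᵘ
import Data.Rational.Unnormalised.Properties as ℚᵘ
open import Data.Sum.Base using (_⊎_; inj₁; inj₂)
open import Data.Vec.Base using ([]; _∷_; tabulate)
open import Data.Vec.Properties using (lookup∘tabulate; lookup⇒[]=; []=⇒lookup)
open import Function.Base using (_∘_)
open import Function.Bundles using (Inverse; Equivalence)
open import Relation.Binary.Definitions using (tri<; tri≈; tri>)
open import Relation.Binary.PropositionalEquality
  using (_≡_; _≢_; refl; sym; trans; cong; cong₂; subst; subst₂; module ≡-Reasoning)
import Relation.Binary.Reasoning.Setoid as SetoidReasoning
open import Relation.Nullary.Decidable using (Dec; does; yes; no; ¬?; _×-dec_; dec-true)
open import Relation.Nullary.Negation using (¬_; contradiction)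
open import Relation.Unary using (Pred; Decidable)
open import Algebra.Properties.Semiring.Sum ℕ.+-*-semiring
  using (sum; sum-cong-≗; ∑-distrib-+; ∑-comm; ∑-permute; *-distribˡ-sum; *-distribʳ-sum)

-- Finite sums and cardinalities

-- The obstacle is the zero divisors, which enter twice. For δ in (z) the slope 2δ is not
-- invertible, so these shifts are bounded trivially: for each s in S every such δ costs at most
-- |R||T|, and the |(z)| of them make up the error |R||(z)|P. Nonunits may also have many square
-- roots, but |A| ≥ 2|(z)| leaves at least half of A among the units. Odd q is what makes 2 a unit,
-- both in the slope and in the count of square roots. Summing over all of R² instead of over A and
-- U lets every inner sum run through the whole ring, where translations and multiplications by
-- units are bijections. This second moment takes the place of a character sum estimate and keeps
-- all quantities natural numbers. The threshold q^(3r-1) is |R|²|(z)|: after multiplication by |A|²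
-- the hypothesis bounds |A + A||A|⁴ from below, the second case bounds it from above, and the
-- factor |R||(z)| common to both cancels.

infixr 6.5 ∑-syntax

∑-syntax : ∀ n → (Fin n → ℕ) → ℕ
∑-syntax _ = sum

syntax ∑-syntax n (λ i → x) = ∑[ i < n ] x

sum-mono : ∀ {n} {f g : Fin n → ℕ} → (∀ i → f i ≤ g i) → sum f ≤ sum g
sum-mono {zero}  f≤g = z≤n
sum-mono {suc n} f≤g = ℕ.+-mono-≤ (f≤g zero) (sum-mono (f≤g ∘ suc))

sum-const : ∀ n c → ∑[ i < n ] c ≡ n * c
sum-const zero    c = refl
sum-const (suc n) c = cong (c +_) (sum-const n c)

term≤sum : ∀ {n} (f : Fin n → ℕ) i → f i ≤ sum f
term≤sum f zero    = ℕ.m≤m+n _ _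
term≤sum f (suc i) = ℕ.≤-trans (term≤sum (f ∘ suc) i) (ℕ.m≤n+m _ _)

sum-reindex : ∀ {n} (f : Fin n → ℕ) (φ ψ : Fin n → Fin n) →
              (∀ i → φ (ψ i) ≡ i) → (∀ i → ψ (φ i) ≡ i) →
              ∑[ i < n ] f (φ i) ≡ sum f
sum-reindex f φ ψ φψ ψφ = sym (∑-permute f (permutation φ ψ φψ ψφ))

𝟙 : ∀ {p} {P : Set p} → Dec P → ℕ
𝟙 P? = if does P? then 1 else 0

𝟙≤1 : ∀ {p} {P : Set p} (P? : Dec P) → 𝟙 P? ≤ 1
𝟙≤1 (yes _) = s≤s z≤n
𝟙≤1 (no  _) = z≤n

𝟙≡1 : ∀ {p} {P : Set p} (P? : Dec P) → P → 𝟙 P? ≡ 1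
𝟙≡1 (yes _) _ = refl
𝟙≡1 (no ¬p) p = contradiction p ¬p

𝟙≡0 : ∀ {p} {P : Set p} (P? : Dec P) → ¬ P → 𝟙 P? ≡ 0
𝟙≡0 (yes p) ¬p = contradiction p ¬p
𝟙≡0 (no _)  _  = refl

𝟙≤ : ∀ {p} {P : Set p} (P? : Dec P) {k} → (P → 1 ≤ k) → 𝟙 P? ≤ k
𝟙≤ (yes p) 1≤k = 1≤k p
𝟙≤ (no _)  1≤k = z≤n

𝟙-idem : ∀ {p} {P : Set p} (P? : Dec P) → 𝟙 P? * 𝟙 P? ≡ 𝟙 P?
𝟙-idem (yes _) = refl
𝟙-idem (no  _) = refl

sum-𝟙≟ : ∀ {n} (j : Fin n) → ∑[ i < n ] 𝟙 (i ≟ j) ≡ 1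
sum-𝟙≟ {suc n} zero = cong suc (trans (sum-const n 0) (ℕ.*-zeroʳ n))
sum-𝟙≟ {suc n} (suc j) = sum-𝟙≟ j

χ : ∀ {n} → Subset n → Fin n → ℕ
χ A i = 𝟙 (i ∈? A)

sum-χ : ∀ {n} (A : Subset n) → sum (χ A) ≡ ∣ A ∣
sum-χ []            = refl
sum-χ (inside  ∷ A) = cong suc (sum-χ A)
sum-χ (outside ∷ A) = sum-χ A

χ-∈ : ∀ {n} (A : Subset n) {i} → i ∈ A → χ A i ≡ 1
χ-∈ A {i} = 𝟙≡1 (i ∈? A)

-- Double count of the pairs with `i ≡ g j`: each `i ∈ A` occurs in at least one, each `j` in
-- exactly one.
∣∣-covered : ∀ {n k} (A : Subset n) (g : Fin k → Fin n) →
             (∀ {i} → i ∈ A → ∃[ j ] i ≡ g j) → ∣ A ∣ ≤ k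
∣∣-covered {n} {k} A g covers = begin
  ∣ A ∣                              ≡⟨ sum-χ A ⟨
  ∑[ i < n ] χ A i                   ≤⟨ sum-mono hit ⟩
  ∑[ i < n ] ∑[ j < k ] 𝟙 (i ≟ g j)  ≡⟨ ∑-comm (λ i j → 𝟙 (i ≟ g j)) ⟩
  ∑[ j < k ] ∑[ i < n ] 𝟙 (i ≟ g j)  ≡⟨ sum-cong-≗ (λ j → sum-𝟙≟ (g j)) ⟩
  ∑[ j < k ] 1                       ≡⟨ trans (sum-const k 1) (ℕ.*-identityʳ k) ⟩
  k                                  ∎
  where
  open ℕ.≤-Reasoning
  hit : ∀ i → χ A i ≤ ∑[ j < k ] 𝟙 (i ≟ g j)
  hit i = 𝟙≤ (i ∈? A) λ i∈A → let (j , i≡gj) = covers i∈A in begin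
    1                        ≡⟨ 𝟙≡1 (i ≟ g j) i≡gj ⟨
    𝟙 (i ≟ g j)              ≤⟨ term≤sum (λ j → 𝟙 (i ≟ g j)) j ⟩
    ∑[ j < k ] 𝟙 (i ≟ g j)   ∎

-- With the larger number written as the smaller plus `d`, the two sides differ by `d * d`.
2ab≤a²+b² : ∀ a b → 2 * (a * b) ≤ a * a + b * b
2ab≤a²+b² a b = by-order (ℕ.≤-total a b)
  where
  identity : ∀ a d → 2 * (a * (a + d)) + d * d ≡ a * a + (a + d) * (a + d)
  identity = solve-∀
  ordered : ∀ {a b} → a ≤ b → 2 * (a * b) ≤ a * a + b * b
  ordered {a} a≤b with ℕ.m≤n⇒∃[o]m+o≡n a≤b
  ... | d , refl = ℕ.≤-trans (ℕ.m≤m+n _ (d * d)) (ℕ.≤-reflexive (identity a d))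
  by-order : a ≤ b ⊎ b ≤ a → 2 * (a * b) ≤ a * a + b * b
  by-order (inj₁ a≤b) = ordered a≤b
  by-order (inj₂ b≤a) = subst₂ _≤_ (cong (2 *_) (ℕ.*-comm b a)) (ℕ.+-comm (b * b) (a * a)) (ordered b≤a)

-- Double sums and a second-moment inequality

∑∑ : ∀ {n} → (Fin n → Fin n → ℕ) → ℕ
∑∑ {n} f = ∑[ i < n ] ∑[ j < n ] f i j

∑∑-mono : ∀ {n} {f g : Fin n → Fin n → ℕ} → (∀ i j → f i j ≤ g i j) → ∑∑ f ≤ ∑∑ g
∑∑-mono f≤g = sum-mono λ i → sum-mono (f≤g i)

∑∑-cong : ∀ {n} {f g : Fin n → Fin n → ℕ} → (∀ i j → f i j ≡ g i j) → ∑∑ f ≡ ∑∑ g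
∑∑-cong f≡g = sum-cong-≗ λ i → sum-cong-≗ (f≡g i)

∑∑-+ : ∀ {n} (f g : Fin n → Fin n → ℕ) → ∑∑ (λ i j → f i j + g i j) ≡ ∑∑ f + ∑∑ g
∑∑-+ f g = trans (sum-cong-≗ λ i → ∑-distrib-+ (f i) (g i)) (∑-distrib-+ (λ i → sum (f i)) (λ i → sum (g i)))

∑∑-*ˡ : ∀ {n} c (f : Fin n → Fin n → ℕ) → ∑∑ (λ i j → c * f i j) ≡ c * ∑∑ f
∑∑-*ˡ c f = trans (sum-cong-≗ λ i → sym (*-distribˡ-sum c (f i))) (sym (*-distribˡ-sum c (λ i → sum (f i))))

∑∑-const : ∀ n c → ∑∑ {n} (λ _ _ → c) ≡ n * (n * c)
∑∑-const n c = trans (sum-cong-≗ {n} λ _ → sum-const n c) (sum-const n (n * c))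

∑∑-separate : ∀ {n} (f g : Fin n → ℕ) → ∑∑ (λ i j → f i * g j) ≡ sum f * sum g
∑∑-separate f g = trans (sum-cong-≗ λ i → sym (*-distribˡ-sum (f i) g)) (sym (*-distribʳ-sum (sum g) f))

-- Four swaps of neighbouring sums carry the order i j k l to k l i j.
∑∑-comm : ∀ {n} (F : Fin n → Fin n → Fin n → Fin n → ℕ) →
          ∑∑ (λ i j → ∑∑ (F i j)) ≡ ∑∑ (λ k l → ∑∑ (λ i j → F i j k l))
∑∑-comm {n} F = begin
  ∑∑ (λ i j → ∑∑ (F i j))
    ≡⟨ sum-cong-≗ (λ i → ∑-comm (λ j k → ∑[ l < n ] F i j k l)) ⟩
  ∑∑ (λ i k → ∑∑ (λ j l → F i j k l))
    ≡⟨ ∑-comm (λ i k → ∑∑ (λ j l → F i j k l)) ⟩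
  ∑∑ (λ k i → ∑∑ (λ j l → F i j k l))
    ≡⟨ ∑∑-cong (λ k i → ∑-comm (λ j l → F i j k l)) ⟩
  ∑∑ (λ k i → ∑∑ (λ l j → F i j k l))
    ≡⟨ sum-cong-≗ (λ k → ∑-comm (λ i l → ∑[ j < n ] F i j k l)) ⟩
  ∑∑ (λ k l → ∑∑ (λ i j → F i j k l))
    ∎
  where open ≡-Reasoning

-- Cauchy–Schwarz for f − P/n against the indicator g, in a form without
-- subtraction: sum 2xy ≤ x² + y² for x = 2Lnf and y = 2LP + nEg.
second-moment :
  ∀ {n} (f g : Fin n → Fin n → ℕ) (P K L E : ℕ) → .{{NonZero n}} → .{{NonZero L}} →
  ∑∑ f ≡ n * P →
  ∑∑ (λ i j → f i j * f i j) ≤ P * P + K →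
  (∀ i j → g i j * g i j ≡ g i j) →
  ∑∑ g ≡ L →
  E ≤ ∑∑ (λ i j → f i j * g i j) →
  2 * (P * L) ≤ n * E →
  E * E ≤ 4 * (L * K)
second-moment {n} f g P K L E ∑f ∑f² g²≡g ∑g E≤ 2PL≤nE =
  ℕ.*-cancelʳ-≤ (E * E) (4 * (L * K)) (L * (n * n)) (ℕ.+-cancelʳ-≤ (3 * X) _ _ (begin
    E * E * (L * (n * n)) + 3 * X                  ≡⟨ e₁ L n E ⟩
    4 * X                                          ≤⟨ ℕ.+-cancelˡ-≤ Z _ _ summed ⟩
    4 * Y + (2 * (P * L) * (2 * (L * (n * E))) + X)
      -- As 2PL ≤ nE, the cross term is at most 2X. What remains after cancelling 3X is X ≤ 4Y, the
      -- claim times L n².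
      ≤⟨ ℕ.+-monoʳ-≤ (4 * Y) (ℕ.+-monoˡ-≤ X (ℕ.*-monoˡ-≤ (2 * (L * (n * E))) 2PL≤nE)) ⟩
    4 * Y + (n * E * (2 * (L * (n * E))) + X)      ≡⟨ e₂ L n E K ⟩
    4 * (L * K) * (L * (n * n)) + 3 * X            ∎))
  where
  open ℕ.≤-Reasoning
  instance
    n²≢0 = ℕ.m*n≢0 n n
    Ln²≢0 = ℕ.m*n≢0 L (n * n)
  X Y Z a b c d : ℕ
  X = L * (n * n) * (E * E)
  Y = L * L * (n * n) * K
  Z = 8 * (L * L * (n * n) * (P * P))
  a = 8 * (L * L * n * P)
  b = 4 * (L * (n * n) * E)
  c = 4 * (L * L * (n * n))
  d = 4 * (L * P * (n * E)) + n * n * (E * E)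
  e₁ : ∀ L n E → E * E * (L * (n * n)) + 3 * (L * (n * n) * (E * E)) ≡ 4 * (L * (n * n) * (E * E))
  e₁ = solve-∀
  e₂ : ∀ L n E K → 4 * (L * L * (n * n) * K) + (n * E * (2 * (L * (n * E))) + L * (n * n) * (E * E))
                  ≡ 4 * (L * K) * (L * (n * n)) + 3 * (L * (n * n) * (E * E))
  e₂ = solve-∀
  e₃ : ∀ L n P E x y → 8 * (L * L * n * P) * x + 4 * (L * (n * n) * E) * (x * y)
                     ≡ 2 * ((2 * L * n * x) * (2 * L * P + n * E * y))
  e₃ = solve-∀
  e₄ : ∀ L n P E x y → (2 * L * n * x) * (2 * L * n * x) + (2 * L * P + n * E * y) * (2 * L * P + n * E * y)
                     ≡ 4 * (L * L * (n * n)) * (x * x) + (4 * (L * P * (n * E)) * y + n * n * (E * E) * (y * y)) + 4 * (L * L * (P * P))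
  e₄ = solve-∀
  e₅ : ∀ L n P E → 8 * (L * L * (n * n) * (P * P)) + 4 * (L * (n * n) * (E * E))
                 ≡ 8 * (L * L * n * P) * (n * P) + 4 * (L * (n * n) * E) * E
  e₅ = solve-∀
  e₆ : ∀ L n P E K → 4 * (L * L * (n * n)) * (P * P + K) + (4 * (L * P * (n * E)) + n * n * (E * E)) * L + n * (n * (4 * (L * L * (P * P))))
                   ≡ 8 * (L * L * (n * n) * (P * P)) + (4 * (L * L * (n * n) * K) + (2 * (P * L) * (2 * (L * (n * E))) + L * (n * n) * (E * E)))
  e₆ = solve-∀
  -- Divided by 2Ln, the square behind this is that of f - P/n - (E/2L) g. On the support of g the
  -- average of f is at least E/L, and 2PL ≤ nE says that the mean P/n is at most half of this; E/2L
  -- is thus a lower bound for the average excess.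
  pointwise : ∀ i j → a * f i j + b * (f i j * g i j) ≤ c * (f i j * f i j) + d * g i j + 4 * (L * L * (P * P))
  pointwise i j = begin
    a * x + b * (x * y)
      ≡⟨ e₃ L n P E x y ⟩
    2 * ((2 * L * n * x) * (2 * L * P + n * E * y))
      ≤⟨ 2ab≤a²+b² (2 * L * n * x) (2 * L * P + n * E * y) ⟩
    (2 * L * n * x) * (2 * L * n * x) + (2 * L * P + n * E * y) * (2 * L * P + n * E * y)
      ≡⟨ e₄ L n P E x y ⟩
    c * (x * x) + (4 * (L * P * (n * E)) * y + n * n * (E * E) * (y * y)) + 4 * (L * L * (P * P))
      ≡⟨ cong (λ t → c * (x * x) + (4 * (L * P * (n * E)) * y + n * n * (E * E) * t) + 4 * (L * L * (P * P))) (g²≡g i j) ⟩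
    c * (x * x) + (4 * (L * P * (n * E)) * y + n * n * (E * E) * y) + 4 * (L * L * (P * P))
      ≡⟨ cong (λ t → c * (x * x) + t + 4 * (L * L * (P * P))) (ℕ.*-distribʳ-+ y (4 * (L * P * (n * E))) (n * n * (E * E))) ⟨
    c * (x * x) + d * y + 4 * (L * L * (P * P)) ∎
    where
    x = f i j
    y = g i j
  summed : Z + 4 * X ≤ Z + (4 * Y + (2 * (P * L) * (2 * (L * (n * E))) + X))
  summed = begin
    Z + 4 * X
      ≡⟨ e₅ L n P E ⟩
    a * (n * P) + b * E
      ≤⟨ ℕ.+-mono-≤ (ℕ.≤-reflexive (cong (a *_) (sym ∑f))) (ℕ.*-monoʳ-≤ b E≤) ⟩
    a * ∑∑ f + b * ∑∑ (λ i j → f i j * g i j)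
      ≡⟨ cong₂ _+_ (∑∑-*ˡ a f) (∑∑-*ˡ b (λ i j → f i j * g i j)) ⟨
    ∑∑ (λ i j → a * f i j) + ∑∑ (λ i j → b * (f i j * g i j))
      ≡⟨ ∑∑-+ (λ i j → a * f i j) (λ i j → b * (f i j * g i j)) ⟨
    ∑∑ (λ i j → a * f i j + b * (f i j * g i j))
      ≤⟨ ∑∑-mono pointwise ⟩
    ∑∑ (λ i j → c * (f i j * f i j) + d * g i j + 4 * (L * L * (P * P)))
      ≡⟨ ∑∑-+ (λ i j → c * (f i j * f i j) + d * g i j) (λ _ _ → 4 * (L * L * (P * P))) ⟩
    ∑∑ (λ i j → c * (f i j * f i j) + d * g i j) + ∑∑ {n} (λ _ _ → 4 * (L * L * (P * P)))
      ≡⟨ cong₂ _+_ (∑∑-+ (λ i j → c * (f i j * f i j)) (λ i j → d * g i j)) (∑∑-const n _) ⟩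
    ∑∑ (λ i j → c * (f i j * f i j)) + ∑∑ (λ i j → d * g i j) + n * (n * (4 * (L * L * (P * P))))
      ≡⟨ cong (_+ n * (n * (4 * (L * L * (P * P))))) (cong₂ _+_ (∑∑-*ˡ c (λ i j → f i j * f i j)) (∑∑-*ˡ d g)) ⟩
    c * ∑∑ (λ i j → f i j * f i j) + d * ∑∑ g + n * (n * (4 * (L * L * (P * P))))
      ≤⟨ ℕ.+-monoˡ-≤ _ (ℕ.+-mono-≤ (ℕ.*-monoʳ-≤ c ∑f²) (ℕ.≤-reflexive (cong (d *_) ∑g))) ⟩
    c * (P * P + K) + d * L + n * (n * (4 * (L * L * (P * P))))
      ≡⟨ e₆ L n P E K ⟩
    Z + (4 * Y + (2 * (P * L) * (2 * (L * (n * E))) + X)) ∎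

-- Sums and squares in a finite local ring on Fin n

-- The interface between ring theory and counting. Elements are indices with propositional equality,
-- so that sums over the ring are sums over `Fin n` and bijections of the ring reindex them. `N`
-- stands for the maximal ideal.
record OddLocalRing (n : ℕ) : Set where
  infixl 6 _⊞_
  infixl 7 _⊠_
  infix  8 ⊟_
  field
    _⊞_ _⊠_           : Op₂ (Fin n)
    ⊟_                : Op₁ (Fin n)
    0R 1R             : Fin n
    isCommutativeRing : IsCommutativeRing _≡_ _⊞_ _⊠_ ⊟_ 0R 1R
    N                 : Subset n
    N-⊞               : ∀ {x y} → x ∈ N → y ∈ N → x ⊞ y ∈ N
    N-⊠               : ∀ x {y} → y ∈ N → x ⊠ y ∈ N
    invertible        : ∀ {x} → x ∉ N → ∃[ y ] y ⊠ x ≡ 1R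
    2∉N               : 1R ⊞ 1R ∉ N

module SquareSums {n : ℕ} (R : OddLocalRing n) where

  open OddLocalRing R

  F : CommutativeRing _ _
  F = record { isCommutativeRing = isCommutativeRing }

  open CommutativeRing F using
    (+-assoc; +-comm; +-identityˡ; +-identityʳ; -‿inverseˡ; -‿inverseʳ; *-assoc; *-comm;
     *-identityˡ; *-identityʳ; zeroʳ; commutativeSemiring; ring)
  open RingProperties ring using (-‿involutive; +-cancelˡ; -1*x≈-x)
  open SemiringSolver commutativeSemiring using (solve; _:=_; _:+_; _:*_; con)

  a⊞[⊟a⊞x]≡x : ∀ a x → a ⊞ (⊟ a ⊞ x) ≡ x
  a⊞[⊟a⊞x]≡x a x = trans (sym (+-assoc a (⊟ a) x)) (trans (cong (_⊞ x) (-‿inverseʳ a)) (+-identityˡ x))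

  ⊟a⊞[a⊞x]≡x : ∀ a x → ⊟ a ⊞ (a ⊞ x) ≡ x
  ⊟a⊞[a⊞x]≡x a x = trans (sym (+-assoc (⊟ a) a x)) (trans (cong (_⊞ x) (-‿inverseˡ a)) (+-identityˡ x))

  sum-shiftˡ : ∀ (f : Fin n → ℕ) c → ∑[ x < n ] f (c ⊞ x) ≡ sum f
  sum-shiftˡ f c = sum-reindex f (c ⊞_) ((⊟ c) ⊞_) (a⊞[⊟a⊞x]≡x c) (⊟a⊞[a⊞x]≡x c)

  sum-shiftʳ : ∀ (f : Fin n → ℕ) c → ∑[ x < n ] f (x ⊞ c) ≡ sum f
  sum-shiftʳ f c = trans (sum-cong-≗ λ x → cong f (+-comm x c)) (sum-shiftˡ f c)

  sum-neg : ∀ (f : Fin n → ℕ) → ∑[ x < n ] f (⊟ x) ≡ sum f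
  sum-neg f = sum-reindex f ⊟_ ⊟_ -‿involutive -‿involutive

  sum-scale : ∀ (f : Fin n → ℕ) {u v} → v ⊠ u ≡ 1R → ∑[ x < n ] f (u ⊠ x) ≡ sum f
  sum-scale f {u} {v} vu≡1 = sum-reindex f (u ⊠_) (v ⊠_) (cancel (trans (*-comm u v) vu≡1)) (cancel vu≡1)
    where
    cancel : ∀ {u v} → v ⊠ u ≡ 1R → ∀ x → v ⊠ (u ⊠ x) ≡ x
    cancel {u} {v} vu≡1 x = trans (sym (*-assoc v u x)) (trans (cong (_⊠ x) vu≡1) (*-identityˡ x))

  invertible-product : ∀ {u u′ v v′} → u′ ⊠ u ≡ 1R → v′ ⊠ v ≡ 1R → (u′ ⊠ v′) ⊠ (u ⊠ v) ≡ 1R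
  invertible-product {u} {u′} {v} {v′} p q =
    trans (solve 4 (λ u u′ v v′ → (u′ :* v′) :* (u :* v) := (u′ :* u) :* (v′ :* v)) refl u u′ v v′)
      (trans (cong₂ _⊠_ p q) (*-identityˡ 1R))

  -- Units and their square roots

  unit-cancel : ∀ {u v} → u ∉ N → v ⊠ u ≡ 0R → v ≡ 0R
  unit-cancel {u} {v} u∉N vu≡0 with invertible u∉N
  ... | u′ , u′u≡1 = begin
    v               ≡⟨ *-identityʳ v ⟨
    v ⊠ 1R          ≡⟨ cong (v ⊠_) u′u≡1 ⟨
    v ⊠ (u′ ⊠ u)    ≡⟨ solve 3 (λ v u′ u → v :* (u′ :* u) := u′ :* (v :* u)) refl v u′ u ⟩
    u′ ⊠ (v ⊠ u)    ≡⟨ cong (u′ ⊠_) vu≡0 ⟩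
    u′ ⊠ 0R         ≡⟨ zeroʳ u′ ⟩
    0R              ∎
    where open ≡-Reasoning

  double∉N : ∀ {y} → y ∉ N → ((1R ⊞ 1R) ⊠ y) ∉ N
  double∉N {y} y∉N 2y∈N with invertible 2∉N
  ... | h , h2≡1 = y∉N (subst (_∈ N)
    (trans (sym (*-assoc h (1R ⊞ 1R) y)) (trans (cong (_⊠ y) h2≡1) (*-identityˡ y)))
    (N-⊠ h 2y∈N))

  -- The product of `w` = x - y and `v` = x + y is zero, which alone decides nothing among zero
  -- divisors. But the factors differ by 2y, which lies outside `N`, so they are not both in `N`;
  -- the one outside is a unit and forces the other to vanish.
  square-roots : ∀ {x y} → y ∉ N → x ⊠ x ≡ y ⊠ y → x ≡ y ⊎ x ≡ ⊟ y
  square-roots {x} {y} y∉N x²≡y² = helper (w ∈? N)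
    where
    open ≡-Reasoning
    w v : Fin n
    w = ⊟ y ⊞ x
    v = w ⊞ (1R ⊞ 1R) ⊠ y
    y+w≡x : y ⊞ w ≡ x
    y+w≡x = a⊞[⊟a⊞x]≡x y x
    v≡y+x : v ≡ y ⊞ x
    v≡y+x = begin
      w ⊞ (1R ⊞ 1R) ⊠ y  ≡⟨ solve 2 (λ w y → w :+ (con 1 :+ con 1) :* y := y :+ (y :+ w)) refl w y ⟩
      y ⊞ (y ⊞ w)        ≡⟨ cong (y ⊞_) y+w≡x ⟩
      y ⊞ x              ∎
    vw≡0 : v ⊠ w ≡ 0R
    vw≡0 = +-cancelˡ (y ⊠ y) _ _ (begin
      y ⊠ y ⊞ v ⊠ w
        ≡⟨ solve 2 (λ y w → y :* y :+ (w :+ (con 1 :+ con 1) :* y) :* w := (y :+ w) :* (y :+ w)) refl y w ⟩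
      (y ⊞ w) ⊠ (y ⊞ w)  ≡⟨ cong₂ _⊠_ y+w≡x y+w≡x ⟩
      x ⊠ x              ≡⟨ x²≡y² ⟩
      y ⊠ y              ≡⟨ +-identityʳ (y ⊠ y) ⟨
      y ⊠ y ⊞ 0R         ∎)
    v∉N : w ∈ N → v ∉ N
    v∉N w∈N v∈N = double∉N y∉N (subst (_∈ N)
      (⊟a⊞[a⊞x]≡x w ((1R ⊞ 1R) ⊠ y))
      (N-⊞ (subst (_∈ N) (-1*x≈-x w) (N-⊠ (⊟ 1R) w∈N)) v∈N))
    helper : Dec (w ∈ N) → x ≡ y ⊎ x ≡ ⊟ y
    helper (yes w∈N) = inj₁ (begin
      x       ≡⟨ y+w≡x ⟨
      y ⊞ w   ≡⟨ cong (y ⊞_) (unit-cancel (v∉N w∈N) (trans (*-comm w v) vw≡0)) ⟩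
      y ⊞ 0R  ≡⟨ +-identityʳ y ⟩
      y       ∎)
    helper (no w∉N) = inj₂ (begin
      x               ≡⟨ ⊟a⊞[a⊞x]≡x y x ⟨
      ⊟ y ⊞ (y ⊞ x)   ≡⟨ cong (⊟ y ⊞_) (trans (sym v≡y+x) (unit-cancel w∉N vw≡0)) ⟩
      ⊟ y ⊞ 0R        ≡⟨ +-identityʳ (⊟ y) ⟩
      ⊟ y             ∎)

  unit-root? : ∀ v x → Dec (x ∉ N × x ⊠ x ≡ v)
  unit-root? v x = ¬? (x ∈? N) ×-dec (x ⊠ x ≟ v)

  unit-roots≤2 : ∀ v → ∑[ x < n ] 𝟙 (unit-root? v x) ≤ 2
  unit-roots≤2 v with any? (unit-root? v)
  ... | no ¬root = ℕ.≤-trans (sum-mono λ x → 𝟙≤ (unit-root? v x) {0} λ root → contradiction (x , root) ¬root)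
                     (ℕ.≤-trans (ℕ.≤-reflexive (trans (sum-const n 0) (ℕ.*-zeroʳ n))) z≤n)
  ... | yes (y , y∉N , y²≡v) = begin
    ∑[ x < n ] 𝟙 (unit-root? v x)                       ≤⟨ sum-mono bound ⟩
    ∑[ x < n ] (𝟙 (x ≟ y) + 𝟙 (x ≟ ⊟ y))                ≡⟨ ∑-distrib-+ (λ x → 𝟙 (x ≟ y)) (λ x → 𝟙 (x ≟ ⊟ y)) ⟩
    ∑[ x < n ] 𝟙 (x ≟ y) + ∑[ x < n ] 𝟙 (x ≟ ⊟ y)       ≡⟨ cong₂ _+_ (sum-𝟙≟ y) (sum-𝟙≟ (⊟ y)) ⟩
    2                                                    ∎
    where
    open ℕ.≤-Reasoning
    bound : ∀ x → 𝟙 (unit-root? v x) ≤ 𝟙 (x ≟ y) + 𝟙 (x ≟ ⊟ y)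
    bound x = 𝟙≤ (unit-root? v x) λ (_ , x²≡v) → split (square-roots y∉N (trans x²≡v (sym y²≡v)))
      where
      split : x ≡ y ⊎ x ≡ ⊟ y → 1 ≤ 𝟙 (x ≟ y) + 𝟙 (x ≟ ⊟ y)
      split (inj₁ x≡y)  = ℕ.≤-trans (ℕ.≤-reflexive (sym (𝟙≡1 (x ≟ y) x≡y))) (ℕ.m≤m+n _ _)
      split (inj₂ x≡-y) = ℕ.≤-trans (ℕ.≤-reflexive (sym (𝟙≡1 (x ≟ ⊟ y) x≡-y))) (ℕ.m≤n+m _ _)

  -- Each element of `A` is in `N` or is one of at most two unit roots of an element of `U`, so |A|
  -- ≤ |N| + 2|U|. Doubling this and absorbing 2|N| into one copy of |A| gives the factor 4.
  ∣A∣≤4∣A²∣ : ∀ {A U : Subset n} → (∀ {x} → x ∈ A → x ⊠ x ∈ U) → 2 * ∣ N ∣ ≤ ∣ A ∣ → ∣ A ∣ ≤ 4 * ∣ U ∣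
  ∣A∣≤4∣A²∣ {A} {U} A²⊆U 2∣N∣≤∣A∣ = begin
    ∣ A ∣          ≤⟨ ℕ.+-cancelʳ-≤ ∣ A ∣ _ _ doubled ⟩
    2 * (∣ U ∣ * 2)  ≡⟨ e₂ ∣ U ∣ ⟩
    4 * ∣ U ∣      ∎
    where
    open ℕ.≤-Reasoning
    e₂ : ∀ u → 2 * (u * 2) ≡ 4 * u
    e₂ = solve-∀
    e₁ : ∀ k u → 2 * (k + u) ≡ 2 * u + 2 * k
    e₁ = solve-∀
    cover : ∀ x → χ A x ≤ χ N x + ∑[ v < n ] χ U v * 𝟙 (unit-root? v x)
    cover x = 𝟙≤ (x ∈? A) λ x∈A → unit-or-not x∈A (x ∈? N)
      where
      unit-or-not : x ∈ A → Dec (x ∈ N) → 1 ≤ χ N x + ∑[ v < n ] χ U v * 𝟙 (unit-root? v x)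
      unit-or-not x∈A (yes x∈N) = ℕ.≤-trans (ℕ.≤-reflexive (sym (χ-∈ N x∈N))) (ℕ.m≤m+n _ _)
      unit-or-not x∈A (no x∉N) = begin
        1                                               ≡⟨ cong₂ _*_ (χ-∈ U (A²⊆U x∈A)) (𝟙≡1 (unit-root? (x ⊠ x) x) (x∉N , refl)) ⟨
        χ U (x ⊠ x) * 𝟙 (unit-root? (x ⊠ x) x)          ≤⟨ term≤sum (λ v → χ U v * 𝟙 (unit-root? v x)) (x ⊠ x) ⟩
        ∑[ v < n ] χ U v * 𝟙 (unit-root? v x)           ≤⟨ ℕ.m≤n+m _ _ ⟩
        χ N x + ∑[ v < n ] χ U v * 𝟙 (unit-root? v x)   ∎
    single : ∣ A ∣ ≤ ∣ N ∣ + ∣ U ∣ * 2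
    single = begin
      ∣ A ∣                                                          ≡⟨ sum-χ A ⟨
      sum (χ A)                                                      ≤⟨ sum-mono cover ⟩
      ∑[ x < n ] (χ N x + ∑[ v < n ] χ U v * 𝟙 (unit-root? v x))     ≡⟨ ∑-distrib-+ (χ N) (λ x → ∑[ v < n ] χ U v * 𝟙 (unit-root? v x)) ⟩
      sum (χ N) + ∑[ x < n ] ∑[ v < n ] χ U v * 𝟙 (unit-root? v x)   ≡⟨ cong₂ _+_ (sum-χ N) (∑-comm (λ x v → χ U v * 𝟙 (unit-root? v x))) ⟩
      ∣ N ∣ + ∑[ v < n ] ∑[ x < n ] χ U v * 𝟙 (unit-root? v x)
        ≡⟨ cong (∣ N ∣ +_) (sum-cong-≗ λ v → *-distribˡ-sum (χ U v) (λ x → 𝟙 (unit-root? v x))) ⟨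
      ∣ N ∣ + ∑[ v < n ] (χ U v * (∑[ x < n ] 𝟙 (unit-root? v x)))
        ≤⟨ ℕ.+-monoʳ-≤ ∣ N ∣ (sum-mono λ v → ℕ.*-monoʳ-≤ (χ U v) (unit-roots≤2 v)) ⟩
      ∣ N ∣ + ∑[ v < n ] χ U v * 2                                   ≡⟨ cong (∣ N ∣ +_) (*-distribʳ-sum 2 (χ U)) ⟨
      ∣ N ∣ + sum (χ U) * 2                                          ≡⟨ cong (λ t → ∣ N ∣ + t * 2) (sum-χ U) ⟩
      ∣ N ∣ + ∣ U ∣ * 2                                              ∎
    doubled : ∣ A ∣ + ∣ A ∣ ≤ 2 * (∣ U ∣ * 2) + ∣ A ∣
    doubled = begin
      ∣ A ∣ + ∣ A ∣                ≡⟨ cong (∣ A ∣ +_) (ℕ.+-identityʳ ∣ A ∣) ⟨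
      2 * ∣ A ∣                    ≤⟨ ℕ.*-monoʳ-≤ 2 single ⟩
      2 * (∣ N ∣ + ∣ U ∣ * 2)      ≡⟨ e₁ (∣ N ∣) (∣ U ∣ * 2) ⟩
      2 * (∣ U ∣ * 2) + 2 * ∣ N ∣  ≤⟨ ℕ.+-monoʳ-≤ (2 * (∣ U ∣ * 2)) 2∣N∣≤∣A∣ ⟩
      2 * (∣ U ∣ * 2) + ∣ A ∣      ∎

  -- Incidences of translated parabolas: first and second moments

  module Incidences (S T : Subset n) where

    -- The number of pairs (s , t) ∈ S × T with (s + e)² + u = t.
    incidences : Fin n → Fin n → ℕ
    incidences e u = ∑[ s < n ] χ S s * χ T ((s ⊞ e) ⊠ (s ⊞ e) ⊞ u)

    χ-square : ∀ (A : Subset n) x → χ A x * χ A x ≡ χ A x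
    χ-square A x = 𝟙-idem (x ∈? A)

    χ≤1 : ∀ (A : Subset n) x → χ A x ≤ 1
    χ≤1 A x = 𝟙≤1 (x ∈? A)

    -- For fixed `e` and `s` the map from `u` to t is a translation, so each `e` contributes |S||T|
    -- exactly.
    ∑-incidences : ∑∑ incidences ≡ n * (∣ S ∣ * ∣ T ∣)
    ∑-incidences = trans (sum-cong-≗ inner) (sum-const n (∣ S ∣ * ∣ T ∣))
      where
      open ≡-Reasoning
      inner : ∀ e → sum (incidences e) ≡ ∣ S ∣ * ∣ T ∣
      inner e = begin
        ∑[ u < n ] ∑[ s < n ] χ S s * χ T ((s ⊞ e) ⊠ (s ⊞ e) ⊞ u)
          ≡⟨ ∑-comm (λ u s → χ S s * χ T ((s ⊞ e) ⊠ (s ⊞ e) ⊞ u)) ⟩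
        ∑[ s < n ] ∑[ u < n ] χ S s * χ T ((s ⊞ e) ⊠ (s ⊞ e) ⊞ u)
          ≡⟨ sum-cong-≗ (λ s → *-distribˡ-sum (χ S s) (λ u → χ T ((s ⊞ e) ⊠ (s ⊞ e) ⊞ u))) ⟨
        ∑[ s < n ] (χ S s * (∑[ u < n ] χ T ((s ⊞ e) ⊠ (s ⊞ e) ⊞ u)))
          ≡⟨ sum-cong-≗ (λ s → cong (χ S s *_) (trans (sum-shiftˡ (χ T) ((s ⊞ e) ⊠ (s ⊞ e))) (sum-χ T))) ⟩
        ∑[ s < n ] χ S s * ∣ T ∣
          ≡⟨ *-distribʳ-sum ∣ T ∣ (χ S) ⟨
        sum (χ S) * ∣ T ∣
          ≡⟨ cong (_* ∣ T ∣) (sum-χ S) ⟩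
        ∣ S ∣ * ∣ T ∣ ∎

    -- The number of ordered pairs of elements of `T` with difference `k`.
    correlation : Fin n → ℕ
    correlation k = ∑[ v < n ] χ T v * χ T (v ⊞ k)

    -- The increment of (s + e)² when `s` moves to s + δ, arranged as a constant plus the slope 2δ
    -- times `e`.
    affine : Fin n → Fin n → Fin n → Fin n
    affine s δ e = (δ ⊠ δ ⊞ (1R ⊞ 1R) ⊠ (s ⊠ δ)) ⊞ ((1R ⊞ 1R) ⊠ δ) ⊠ e

    -- The slope 2δ is a unit, so `affine s δ` permutes the ring and the sum meets each difference
    -- once; every ordered pair from `T` has exactly one difference.
    ∑-correlation-unit : ∀ s {δ} → δ ∉ N → ∑[ e < n ] correlation (affine s δ e) ≡ ∣ T ∣ * ∣ T ∣
    ∑-correlation-unit s {δ} δ∉N = begin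
      ∑[ e < n ] correlation (affine s δ e)
        ≡⟨ sum-scale (λ x → correlation (c ⊞ x)) (invertible-product (proj₂ (invertible 2∉N)) (proj₂ (invertible δ∉N))) ⟩
      ∑[ e < n ] correlation (c ⊞ e)
        ≡⟨ sum-shiftˡ correlation c ⟩
      ∑[ e < n ] ∑[ v < n ] χ T v * χ T (v ⊞ e)
        ≡⟨ ∑-comm (λ e v → χ T v * χ T (v ⊞ e)) ⟩
      ∑[ v < n ] ∑[ e < n ] χ T v * χ T (v ⊞ e)
        ≡⟨ sum-cong-≗ (λ v → *-distribˡ-sum (χ T v) (λ e → χ T (v ⊞ e))) ⟨
      ∑[ v < n ] (χ T v * (∑[ e < n ] χ T (v ⊞ e)))
        ≡⟨ sum-cong-≗ (λ v → cong (χ T v *_) (sum-shiftˡ (χ T) v)) ⟩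
      ∑[ v < n ] χ T v * sum (χ T)
        ≡⟨ *-distribʳ-sum (sum (χ T)) (χ T) ⟨
      sum (χ T) * sum (χ T)
        ≡⟨ cong₂ _*_ (sum-χ T) (sum-χ T) ⟩
      ∣ T ∣ * ∣ T ∣ ∎
      where
      open ≡-Reasoning
      c = δ ⊠ δ ⊞ (1R ⊞ 1R) ⊠ (s ⊠ δ)

    correlation≤ : ∀ k → correlation k ≤ ∣ T ∣
    correlation≤ k = begin
      ∑[ v < n ] χ T v * χ T (v ⊞ k)  ≤⟨ sum-mono (λ v → ℕ.*-monoʳ-≤ (χ T v) (χ≤1 T (v ⊞ k))) ⟩
      ∑[ v < n ] χ T v * 1            ≡⟨ sum-cong-≗ (λ v → ℕ.*-identityʳ (χ T v)) ⟩
      sum (χ T)                       ≡⟨ sum-χ T ⟩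
      ∣ T ∣                           ∎
      where open ℕ.≤-Reasoning

    -- For `δ` in `N` each correlation is bounded by |T|. The error term leaves out the factor
    -- `χ S (s ⊞ δ)`, so that its sum over `δ` is |N| n |T| whatever `s` is.
    ∑-correlation : ∀ s δ → χ S (s ⊞ δ) * (∑[ e < n ] correlation (affine s δ e))
                            ≤ χ S (s ⊞ δ) * (∣ T ∣ * ∣ T ∣) + χ N δ * (n * ∣ T ∣)
    ∑-correlation s δ = helper (δ ∈? N)
      where
      open ℕ.≤-Reasoning
      helper : Dec (δ ∈ N) → χ S (s ⊞ δ) * (∑[ e < n ] correlation (affine s δ e))
                             ≤ χ S (s ⊞ δ) * (∣ T ∣ * ∣ T ∣) + χ N δ * (n * ∣ T ∣)
      helper (no δ∉N) = ℕ.≤-trans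
        (ℕ.≤-reflexive (cong (χ S (s ⊞ δ) *_) (∑-correlation-unit s δ∉N))) (ℕ.m≤m+n _ _)
      helper (yes δ∈N) = begin
        χ S (s ⊞ δ) * (∑[ e < n ] correlation (affine s δ e))
          ≤⟨ ℕ.*-mono-≤ (χ≤1 S (s ⊞ δ)) (sum-mono λ e → correlation≤ (affine s δ e)) ⟩
        1 * (∑[ e < n ] ∣ T ∣)
          ≡⟨ cong₂ _*_ (sym (χ-∈ N δ∈N)) (sum-const n ∣ T ∣) ⟩
        χ N δ * (n * ∣ T ∣)
          ≤⟨ ℕ.m≤n+m _ _ ⟩
        χ S (s ⊞ δ) * (∣ T ∣ * ∣ T ∣) + χ N δ * (n * ∣ T ∣) ∎

    -- Pairs of solutions for one (e, u), the second recorded by its shift `δ` from the first: then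
    -- t′ - t is `affine s δ e`, from which `u` has disappeared.
    pairs : Fin n → Fin n → Fin n → Fin n → ℕ
    pairs e u s δ = (χ S s * χ S (s ⊞ δ)) *
      (χ T ((s ⊞ e) ⊠ (s ⊞ e) ⊞ u) * χ T (((s ⊞ e) ⊠ (s ⊞ e) ⊞ u) ⊞ affine s δ e))

    incidences²≡∑pairs : ∀ e u → incidences e u * incidences e u ≡ ∑∑ (pairs e u)
    incidences²≡∑pairs e u = begin
      incidences e u * incidences e u
        ≡⟨ ∑∑-separate h h ⟨
      ∑[ s < n ] ∑[ s′ < n ] h s * h s′
        ≡⟨ sum-cong-≗ (λ s → sum-shiftˡ (λ s′ → h s * h s′) s) ⟨
      ∑[ s < n ] ∑[ δ < n ] h s * h (s ⊞ δ)
        ≡⟨ ∑∑-cong (λ s δ → trans (rearrange (χ S s) _ (χ S (s ⊞ δ)) _)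
             (cong (λ t → (χ S s * χ S (s ⊞ δ)) * (χ T ((s ⊞ e) ⊠ (s ⊞ e) ⊞ u) * χ T t)) (expand s δ))) ⟩
      ∑∑ (pairs e u) ∎
      where
      open ≡-Reasoning
      h : Fin n → ℕ
      h s = χ S s * χ T ((s ⊞ e) ⊠ (s ⊞ e) ⊞ u)
      rearrange : ∀ a b c d → (a * b) * (c * d) ≡ (a * c) * (b * d)
      rearrange = solve-∀
      expand : ∀ s δ → ((s ⊞ δ) ⊞ e) ⊠ ((s ⊞ δ) ⊞ e) ⊞ u ≡ ((s ⊞ e) ⊠ (s ⊞ e) ⊞ u) ⊞ affine s δ e
      expand s δ = solve 4 (λ s δ e u →
        ((s :+ δ) :+ e) :* ((s :+ δ) :+ e) :+ u :=
        ((s :+ e) :* (s :+ e) :+ u) :+ ((δ :* δ :+ (con 1 :+ con 1) :* (s :* δ)) :+ ((con 1 :+ con 1) :* δ) :* e)) refl s δ e u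

    -- For fixed `e` the substitution v = (s + e)² + u is a translation in `u` and turns the inner
    -- sum into a correlation of `T`.
    ∑-pairs : ∀ s δ → ∑∑ (λ e u → pairs e u s δ) ≡ χ S s * (χ S (s ⊞ δ) * (∑[ e < n ] correlation (affine s δ e)))
    ∑-pairs s δ = begin
      ∑∑ (λ e u → (χ S s * χ S (s ⊞ δ)) * τ e ((s ⊞ e) ⊠ (s ⊞ e) ⊞ u))
        ≡⟨ ∑∑-*ˡ (χ S s * χ S (s ⊞ δ)) (λ e u → τ e ((s ⊞ e) ⊠ (s ⊞ e) ⊞ u)) ⟩
      (χ S s * χ S (s ⊞ δ)) * ∑∑ (λ e u → τ e ((s ⊞ e) ⊠ (s ⊞ e) ⊞ u))
        ≡⟨ cong ((χ S s * χ S (s ⊞ δ)) *_) (sum-cong-≗ λ e → sum-shiftˡ (τ e) ((s ⊞ e) ⊠ (s ⊞ e))) ⟩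
      (χ S s * χ S (s ⊞ δ)) * (∑[ e < n ] correlation (affine s δ e))
        ≡⟨ ℕ.*-assoc (χ S s) (χ S (s ⊞ δ)) _ ⟩
      χ S s * (χ S (s ⊞ δ) * (∑[ e < n ] correlation (affine s δ e))) ∎
      where
      open ≡-Reasoning
      τ : Fin n → Fin n → ℕ
      τ e v = χ T v * χ T (v ⊞ affine s δ e)

    ∑-incidences² : ∑∑ (λ e u → incidences e u * incidences e u)
                    ≤ (∣ S ∣ * ∣ T ∣) * (∣ S ∣ * ∣ T ∣) + n * ∣ N ∣ * (∣ S ∣ * ∣ T ∣)
    ∑-incidences² = begin
      ∑∑ (λ e u → incidences e u * incidences e u)
        ≡⟨ ∑∑-cong incidences²≡∑pairs ⟩
      ∑∑ (λ e u → ∑∑ (pairs e u))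
        ≡⟨ ∑∑-comm pairs ⟩
      ∑∑ (λ s δ → ∑∑ (λ e u → pairs e u s δ))
        ≡⟨ ∑∑-cong ∑-pairs ⟩
      ∑∑ (λ s δ → χ S s * (χ S (s ⊞ δ) * (∑[ e < n ] correlation (affine s δ e))))
        ≤⟨ ∑∑-mono (λ s δ → ℕ.*-monoʳ-≤ (χ S s) (∑-correlation s δ)) ⟩
      ∑[ s < n ] ∑[ δ < n ] χ S s * (χ S (s ⊞ δ) * T² + χ N δ * (n * ∣ T ∣))
        ≡⟨ sum-cong-≗ (λ s → trans (sym (*-distribˡ-sum (χ S s) (λ δ → χ S (s ⊞ δ) * T² + χ N δ * (n * ∣ T ∣))))
             (cong (χ S s *_) (inner s))) ⟩
      ∑[ s < n ] χ S s * (∣ S ∣ * T² + ∣ N ∣ * (n * ∣ T ∣))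
        ≡⟨ *-distribʳ-sum (∣ S ∣ * T² + ∣ N ∣ * (n * ∣ T ∣)) (χ S) ⟨
      sum (χ S) * (∣ S ∣ * T² + ∣ N ∣ * (n * ∣ T ∣))
        ≡⟨ cong (_* (∣ S ∣ * T² + ∣ N ∣ * (n * ∣ T ∣))) (sum-χ S) ⟩
      ∣ S ∣ * (∣ S ∣ * T² + ∣ N ∣ * (n * ∣ T ∣))
        ≡⟨ e₁ (∣ S ∣) (∣ T ∣) n (∣ N ∣) ⟩
      (∣ S ∣ * ∣ T ∣) * (∣ S ∣ * ∣ T ∣) + n * ∣ N ∣ * (∣ S ∣ * ∣ T ∣) ∎
      where
      open ℕ.≤-Reasoning
      T² : ℕ
      T² = ∣ T ∣ * ∣ T ∣
      e₁ : ∀ s t n m → s * (s * (t * t) + m * (n * t)) ≡ (s * t) * (s * t) + n * m * (s * t)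
      e₁ = solve-∀
      inner : ∀ s → ∑[ δ < n ] (χ S (s ⊞ δ) * T² + χ N δ * (n * ∣ T ∣)) ≡ ∣ S ∣ * T² + ∣ N ∣ * (n * ∣ T ∣)
      inner s = trans (∑-distrib-+ (λ δ → χ S (s ⊞ δ) * T²) (λ δ → χ N δ * (n * ∣ T ∣))) (cong₂ _+_
        (trans (sym (*-distribʳ-sum T² (λ δ → χ S (s ⊞ δ)))) (cong (_* T²) (trans (sum-shiftˡ (χ S) s) (sum-χ S))))
        (trans (sym (*-distribʳ-sum (n * ∣ T ∣) (χ N))) (cong (_* (n * ∣ T ∣)) (sum-χ N))))

  -- From incidences to the dichotomy

  ∣A∣≤∣A+A∣ : ∀ {A S : Subset n} → (∀ {x y} → x ∈ A → y ∈ A → x ⊞ y ∈ S) → ∣ A ∣ ≤ ∣ S ∣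
  ∣A∣≤∣A+A∣ {A} {S} A+A⊆S with nonempty? A
  ... | no A-empty = ℕ.≤-trans (ℕ.≤-reflexive (trans (cong ∣_∣ (Empty-unique A-empty)) (∣⊥∣≡0 n))) z≤n
  ... | yes (a , a∈A) = begin
    ∣ A ∣                      ≡⟨ sum-χ A ⟨
    sum (χ A)                  ≤⟨ sum-mono (λ x → 𝟙≤ (x ∈? A) λ x∈A → ℕ.≤-reflexive (sym (χ-∈ S (A+A⊆S a∈A x∈A)))) ⟩
    ∑[ x < n ] χ S (a ⊞ x)     ≡⟨ sum-shiftˡ (χ S) a ⟩
    sum (χ S)                  ≡⟨ sum-χ S ⟩
    ∣ S ∣                      ∎
    where open ℕ.≤-Reasoning

  -- The split compares the mean P/n with |A|/2, half of the guaranteed number of solutions at each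
  -- (a, u). If the mean is at least that, the first alternative is this comparison itself.
  -- Otherwise the surplus is governed by the second moment; 16 is the 4 of `second-moment` times
  -- the 4 of `∣A∣≤4∣A²∣`.
  sum-product-dichotomy : ∀ {A S U T : Subset n} →
    (∀ {x y} → x ∈ A → y ∈ A → x ⊞ y ∈ S) →
    (∀ {x} → x ∈ A → x ⊠ x ∈ U) →
    (∀ {x y} → x ∈ U → y ∈ U → x ⊞ y ∈ T) →
    0 < ∣ A ∣ → 2 * ∣ N ∣ ≤ ∣ A ∣ →
    n * ∣ A ∣ ≤ 2 * (∣ S ∣ * ∣ T ∣) ⊎
    ∣ A ∣ * ∣ A ∣ * (∣ A ∣ * ∣ A ∣) ≤ 16 * (n * ∣ N ∣ * (∣ S ∣ * ∣ T ∣))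
  sum-product-dichotomy {A} {S} {U} {T} A+A⊆S A²⊆U U+U⊆T 0<∣A∣ 2∣N∣≤∣A∣ = cases (ℕ.≤-total (2 * (P * L)) (n * E))
    where
    open Incidences S T
    open ℕ.≤-Reasoning
    a u P L E K : ℕ
    a = ∣ A ∣
    u = ∣ U ∣
    P = ∣ S ∣ * ∣ T ∣
    L = a * u
    E = a * a * u
    K = n * ∣ N ∣ * P

    a≤4u : a ≤ 4 * u
    a≤4u = ∣A∣≤4∣A²∣ A²⊆U 2∣N∣≤∣A∣

    instance
      a≢0 : NonZero a
      a≢0 = >-nonZero 0<∣A∣
      n≢0 : NonZero n
      n≢0 = >-nonZero (ℕ.≤-trans 0<∣A∣ (∣p∣≤n A))
      u≢0 : NonZero u
      u≢0 = ℕ.m*n≢0⇒n≢0 4 {{>-nonZero (ℕ.≤-trans 0<∣A∣ a≤4u)}}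
      L≢0 : NonZero L
      L≢0 = ℕ.m*n≢0 a u

    -- The parameter `e` is -a, since `incidences` is written with s + e in place of s - a.
    lines : Fin n → Fin n → ℕ
    lines e v = χ A (⊟ e) * χ U v

    ∑-χA⊟ : ∑[ e < n ] χ A (⊟ e) ≡ a
    ∑-χA⊟ = trans (sum-neg (χ A)) (sum-χ A)

    ∑lines : ∑∑ lines ≡ L
    ∑lines = trans (∑∑-separate (λ e → χ A (⊟ e)) (χ U)) (cong₂ _*_ ∑-χA⊟ (sum-χ U))

    lines-idem : ∀ e v → lines e v * lines e v ≡ lines e v
    lines-idem e v = trans (swap (χ A (⊟ e)) (χ U v)) (cong₂ _*_ (χ-square A (⊟ e)) (χ-square U v))
      where
      swap : ∀ x y → (x * y) * (x * y) ≡ (x * x) * (y * y)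
      swap = solve-∀

    rich : ∀ {e v} → ⊟ e ∈ A → v ∈ U → a ≤ incidences e v
    rich {e} {v} -e∈A v∈U = begin
      a                    ≡⟨ sum-χ A ⟨
      sum (χ A)            ≤⟨ sum-mono (λ b → 𝟙≤ (b ∈? A) (hit b)) ⟩
      ∑[ b < n ] h (b ⊞ ⊟ e) ≡⟨ sum-shiftʳ h (⊟ e) ⟩
      sum h ∎
      where
      h : Fin n → ℕ
      h s = χ S s * χ T ((s ⊞ e) ⊠ (s ⊞ e) ⊞ v)
      undo : ∀ b → (b ⊞ ⊟ e) ⊞ e ≡ b
      undo b = trans (+-assoc b (⊟ e) e) (trans (cong (b ⊞_) (-‿inverseˡ e)) (+-identityʳ b))
      hit : ∀ b → b ∈ A → 1 ≤ h (b ⊞ ⊟ e)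
      hit b b∈A = ℕ.≤-reflexive (sym (cong₂ _*_ (χ-∈ S (A+A⊆S b∈A -e∈A))
        (trans (cong (λ t → χ T (t ⊠ t ⊞ v)) (undo b)) (χ-∈ T (U+U⊆T (A²⊆U b∈A) v∈U)))))

    E≤ : E ≤ ∑∑ (λ e v → incidences e v * lines e v)
    E≤ = begin
      a * a * u                                     ≡⟨ ℕ.*-assoc a a u ⟩
      a * L                                         ≡⟨ cong (a *_) ∑lines ⟨
      a * ∑∑ lines                                  ≡⟨ ∑∑-*ˡ a lines ⟨
      ∑∑ (λ e v → a * lines e v)                    ≤⟨ ∑∑-mono pointwise ⟩
      ∑∑ (λ e v → incidences e v * lines e v)       ∎
      where
      pointwise : ∀ e v → a * lines e v ≤ incidences e v * lines e v
      pointwise e v with ⊟ e ∈? A | v ∈? U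
      ... | yes -e∈A | yes v∈U = ℕ.*-monoˡ-≤ 1 (rich -e∈A v∈U)
      ... | yes _    | no  _   = ℕ.≤-trans (ℕ.≤-reflexive (ℕ.*-zeroʳ a)) z≤n
      ... | no _     | _       = ℕ.≤-trans (ℕ.≤-reflexive (ℕ.*-zeroʳ a)) z≤n

    e₁ : ∀ n a u → n * (a * a * u) ≡ n * a * (a * u)
    e₁ = solve-∀
    e₂ : ∀ a u → a * a * a * u * (a * u) ≡ a * a * u * (a * a * u)
    e₂ = solve-∀
    e₃ : ∀ a u k → 4 * (a * u * k) ≡ 4 * k * (a * u)
    e₃ = solve-∀
    e₄ : ∀ a u → a * a * a * (4 * u) ≡ 4 * (a * a * a * u)
    e₄ = solve-∀

    cases : _ → _
    cases (inj₂ nE≤2PL) = inj₁ (ℕ.*-cancelʳ-≤ (n * a) (2 * P) L (begin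
      n * a * L    ≡⟨ e₁ n a u ⟨
      n * E        ≤⟨ nE≤2PL ⟩
      2 * (P * L)  ≡⟨ ℕ.*-assoc 2 P L ⟨
      2 * P * L    ∎))
    -- E² is a³u times L, so cancelling L from E² ≤ 4LK leaves a³u ≤ 4K; the fourth factor a is
    -- first traded for 4u.
    cases (inj₁ 2PL≤nE) = inj₂ (begin
      a * a * (a * a)        ≡⟨ ℕ.*-assoc (a * a) a a ⟨
      a * a * a * a          ≤⟨ ℕ.*-monoʳ-≤ (a * a * a) a≤4u ⟩
      a * a * a * (4 * u)    ≡⟨ e₄ a u ⟩
      4 * (a * a * a * u)    ≤⟨ ℕ.*-monoʳ-≤ 4 (ℕ.*-cancelʳ-≤ (a * a * a * u) (4 * K) L (begin
        a * a * a * u * L    ≡⟨ e₂ a u ⟩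
        E * E                ≤⟨ second-moment incidences lines P K L E ∑-incidences ∑-incidences² lines-idem ∑lines E≤ 2PL≤nE ⟩
        4 * (L * K)          ≡⟨ e₃ a u K ⟩
        4 * K * L            ∎)) ⟩
      4 * (4 * K)            ≡⟨ ℕ.*-assoc 4 4 K ⟨
      16 * K                 ∎)

-- Structure of a finite valuation ring

∈-comprehension⁺ : ∀ {n p} {P : Pred (Fin n) p} (P? : Decidable P) {i} → P i → i ∈ tabulate (does ∘ P?)
∈-comprehension⁺ P? {i} p = lookup⇒[]= i _ (trans (lookup∘tabulate (does ∘ P?) i) (dec-true (P? i) p))

does-true⇒ : ∀ {p} {P : Set p} (P? : Dec P) → does P? ≡ true → P
does-true⇒ (yes p) _ = p

∈-comprehension⁻ : ∀ {n p} {P : Pred (Fin n) p} (P? : Decidable P) {i} → i ∈ tabulate (does ∘ P?) → P i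
∈-comprehension⁻ P? {i} i∈ = does-true⇒ (P? i) (trans (sym (lookup∘tabulate (does ∘ P?) i)) ([]=⇒lookup i∈))

-- Of each orbit {i , σ i} exactly one element lies below its image.
involution⇒even : ∀ {n} (σ : Fin n → Fin n) → (∀ i → σ (σ i) ≡ i) → (∀ i → σ i ≢ i) → 2 ∣ℕ n
involution⇒even {n} σ σσ σ≢ = divides k (begin
  n                                               ≡⟨ trans (sum-const n 1) (ℕ.*-identityʳ n) ⟨
  ∑[ i < n ] 1                                    ≡⟨ sum-cong-≗ one ⟩
  ∑[ i < n ] (up i + 𝟙 (σ i <? i))                ≡⟨ ∑-distrib-+ up (λ i → 𝟙 (σ i <? i)) ⟩
  k + (∑[ i < n ] 𝟙 (σ i <? i))                   ≡⟨ cong (k +_) (sum-cong-≗ λ i → cong (λ j → 𝟙 (σ i <? j)) (σσ i)) ⟨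
  k + (∑[ i < n ] up (σ i))                       ≡⟨ cong (k +_) (sum-reindex up σ σ σσ σσ) ⟩
  k + k                                           ≡⟨ double k ⟩
  k * 2                                           ∎)
  where
  open ≡-Reasoning
  up : Fin n → ℕ
  up i = 𝟙 (i <? σ i)
  k : ℕ
  k = sum up
  double : ∀ k → k + k ≡ k * 2
  double = solve-∀
  one : ∀ i → 1 ≡ up i + 𝟙 (σ i <? i)
  one i with <-cmp i (σ i)
  ... | tri< i<σi _ σi≮i = sym (cong₂ _+_ (𝟙≡1 (i <? σ i) i<σi) (𝟙≡0 (σ i <? i) σi≮i))
  ... | tri≈ _ i≡σi _    = contradiction (sym i≡σi) (σ≢ i)
  ... | tri> i≮σi _ σi<i = sym (cong₂ _+_ (𝟙≡0 (i <? σ i) i≮σi) (𝟙≡1 (σ i <? i) σi<i))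

2∤oddPrimePower : ∀ {q} → OddPrimePower q → ¬ 2 ∣ℕ q
2∤oddPrimePower (p , k , p-prime , p≢2 , _ , refl) 2∣p^k = contradiction (2∣p k 2∣p^k) 2∤p
  where
  2∤p : ¬ 2 ∣ℕ p
  2∤p 2∣p with prime⇒irreducible p-prime 2∣p
  ... | inj₂ 2≡p = p≢2 (sym 2≡p)
  2∣p : ∀ k → 2 ∣ℕ p ^ k → 2 ∣ℕ p
  2∣p zero 2∣1 = contradiction (∣1⇒≡1 2∣1) λ()
  2∣p (suc k) 2∣p^[1+k] with euclidsLemma p (p ^ k) prime[2] 2∣p^[1+k]
  ... | inj₁ 2∣p   = 2∣p
  ... | inj₂ 2∣p^k = 2∣p k 2∣p^k

oddPrimePower>0 : ∀ {q} → OddPrimePower q → 0 < q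
oddPrimePower>0 (p , k , p-prime , _ , _ , refl) = ℕ.m^n>0 p {{prime⇒nonZero p-prime}} k

module Structure
  {a ℓ} (V : FiniteValuationRing a ℓ) {z : FiniteValuationRing.Carrier V} {q r : ℕ}
  (uniformizer : FiniteValuationRing.IsUniformizer V z)
  (residue : HasSize (FiniteValuationRing.residueField V z) q)
  (nilpotency : FiniteValuationRing.IsNilpotencyIndex V z r)
  where

  open FiniteValuationRing V renaming (_∈_ to _∈ᴿ_)

  private
    module R = CommutativeRing commutativeRing
  open CommutativeRing commutativeRing using (_≈_; 0#; 1#; setoid; ring; semiring; commutativeSemiring)
    renaming (_+_ to _+ᴿ_; _*_ to _*ᴿ_; -_ to -ᴿ_; _-_ to _-ᴿ_)
  open Divisibility semiring using (_∣_; _,_)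
  open Exp semiring using () renaming (_^_ to _^ᴿ_)
  open RingProperties ring using (+-cancelˡ)
  open SemiringSolver commutativeSemiring using (solve; _:=_; _:+_; _:*_; con)
  open Inverse size using () renaming (to to index; from to element; to-cong to index-cong; from-cong to element-cong;
    strictlyInverseˡ to index-element; strictlyInverseʳ to element-index)
  open IsNilpotencyIndex nilpotency
  open SetoidReasoning setoid

  M : Subset order
  M = proj₁ uniformizer

  open IsMaximalIdeal (proj₁ (proj₂ uniformizer))
  open IsIdeal isIdeal

  ∈ᴿ-resp : ∀ {A x y} → x ≈ y → x ∈ᴿ A → y ∈ᴿ A
  ∈ᴿ-resp {A} x≈y = subst (_∈ A) (index-cong x≈y)

  ∈⇒element : ∀ {A i} → i ∈ A → element i ∈ᴿ A
  ∈⇒element {A} {i} = subst (_∈ A) (sym (index-element i))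

  M⇒∣ : ∀ {x} → x ∈ᴿ M → z ∣ x
  M⇒∣ {x} = Equivalence.to (proj₂ (proj₂ uniformizer) x)

  ∣⇒M : ∀ {x} → z ∣ x → x ∈ᴿ M
  ∣⇒M {x} = Equivalence.from (proj₂ (proj₂ uniformizer) x)

  1∉M : ¬ 1# ∈ᴿ M
  1∉M 1∈M = proper (⊆-antisym ⊆⊤ λ {i} _ → subst (_∈ M) (index-element i)
    (∈ᴿ-resp (R.*-identityʳ (element i)) (*-closed (element i) 1∈M)))

  -- For x ∉ M the ideal M + (x) is everything.
  comaximal : ∀ {x} → ¬ x ∈ᴿ M → ∃[ b ] ∃[ c ] b *ᴿ x +ᴿ c *ᴿ z ≈ 1#
  comaximal {x} x∉M = conclude (maximal I I-ideal M⊆I)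
    where
    P : Fin order → Set
    P k = ∃[ j ] ∃[ i ] (j ∈ M × k ≡ index (element j +ᴿ element i *ᴿ x))
    P? : Decidable P
    P? k = any? λ j → any? λ i → (j ∈? M) ×-dec (k ≟ index (element j +ᴿ element i *ᴿ x))
    I : Subset order
    I = comprehension P?
    into : ∀ {m y} b → m ∈ᴿ M → y ≈ m +ᴿ b *ᴿ x → y ∈ᴿ I
    into {m} {y} b m∈M y≈ = ∈-comprehension⁺ P? (index m , index b , m∈M , index-cong (begin
      y                                              ≈⟨ y≈ ⟩
      m +ᴿ b *ᴿ x                                    ≈⟨ R.+-cong (element-index m) (R.*-congʳ (element-index b)) ⟨
      element (index m) +ᴿ element (index b) *ᴿ x    ∎))
    from-I : ∀ {y} → y ∈ᴿ I → ∃[ m ] ∃[ b ] (m ∈ᴿ M × y ≈ m +ᴿ b *ᴿ x)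
    from-I {y} y∈I with ∈-comprehension⁻ P? y∈I
    ... | j , i , j∈M , eq = element j , element i , ∈⇒element j∈M , (begin
      y                                                    ≈⟨ element-index y ⟨
      element (index y)                                    ≈⟨ element-cong eq ⟩
      element (index (element j +ᴿ element i *ᴿ x))        ≈⟨ element-index _ ⟩
      element j +ᴿ element i *ᴿ x                          ∎)
    I-ideal : IsIdeal I
    I-ideal = record
      { 0∈ = into 0# 0∈ (solve 1 (λ x → con 0 := con 0 :+ con 0 :* x) R.refl x)
      ; +-closed = λ y∈I y′∈I → let (m , b , m∈M , y≈) = from-I y∈I; (m′ , b′ , m′∈M , y′≈) = from-I y′∈I in
          into (b +ᴿ b′) (+-closed m∈M m′∈M) (R.trans (R.+-cong y≈ y′≈)
            (solve 5 (λ m b m′ b′ x → (m :+ b :* x) :+ (m′ :+ b′ :* x) := (m :+ m′) :+ (b :+ b′) :* x) R.refl m b m′ b′ x))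
      ; *-closed = λ w y∈I → let (m , b , m∈M , y≈) = from-I y∈I in
          into (w *ᴿ b) (*-closed w m∈M) (R.trans (R.*-congˡ y≈)
            (solve 4 (λ w m b x → w :* (m :+ b :* x) := w :* m :+ (w :* b) :* x) R.refl w m b x))
      }
    M⊆I : ∀ {k} → k ∈ M → k ∈ I
    M⊆I {k} k∈M = subst (_∈ I) (index-element k)
      (into 0# (∈⇒element k∈M) (solve 2 (λ m x → m := m :+ con 0 :* x) R.refl (element k) x))
    x∈I : x ∈ᴿ I
    x∈I = into 1# 0∈ (solve 1 (λ x → x := con 0 :+ con 1 :* x) R.refl x)
    conclude : I ≡ M ⊎ I ≡ ⊤ → ∃[ b ] ∃[ c ] b *ᴿ x +ᴿ c *ᴿ z ≈ 1#
    conclude (inj₁ I≡M) = contradiction (subst (x ∈ᴿ_) I≡M x∈I) x∉M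
    conclude (inj₂ I≡⊤) with from-I (subst (1# ∈ᴿ_) (sym I≡⊤) ∈⊤)
    ... | m , b , m∈M , 1≈ with M⇒∣ m∈M
    ...   | c , cz≈m = b , c , (begin
      b *ᴿ x +ᴿ c *ᴿ z   ≈⟨ R.+-comm _ _ ⟩
      c *ᴿ z +ᴿ b *ᴿ x   ≈⟨ R.+-congʳ cz≈m ⟩
      m +ᴿ b *ᴿ x        ≈⟨ 1≈ ⟨
      1#                 ∎)

  -- An inverse modulo z^k is lifted to one modulo z^(k+1): the error c z^k is multiplied by b x +
  -- c′ z ≈ 1, its x-part joins the inverse and the rest gains a factor z. At k = r the error
  -- vanishes.
  unit-modulo : ∀ {x} → ¬ x ∈ᴿ M → ∀ k → ∃[ y ] ∃[ c ] y *ᴿ x +ᴿ c *ᴿ z ^ᴿ k ≈ 1#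
  unit-modulo {x} x∉M zero = 0# , 1# , solve 1 (λ x → con 0 :* x :+ con 1 :* con 1 := con 1) R.refl x
  unit-modulo {x} x∉M (suc k) with unit-modulo x∉M k | comaximal x∉M
  ... | y , c , eq | b , c′ , eq′ = y +ᴿ b *ᴿ c *ᴿ z ^ᴿ k , c *ᴿ c′ , (begin
    (y +ᴿ b *ᴿ c *ᴿ z ^ᴿ k) *ᴿ x +ᴿ c *ᴿ c′ *ᴿ (z *ᴿ z ^ᴿ k)
      ≈⟨ solve 7 (λ x y c b c′ z w → (y :+ b :* c :* w) :* x :+ c :* c′ :* (z :* w) := y :* x :+ c :* w :* (b :* x :+ c′ :* z))
           R.refl x y c b c′ z (z ^ᴿ k) ⟩
    y *ᴿ x +ᴿ c *ᴿ z ^ᴿ k *ᴿ (b *ᴿ x +ᴿ c′ *ᴿ z)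
      ≈⟨ R.+-congˡ (R.trans (R.*-congˡ eq′) (R.*-identityʳ _)) ⟩
    y *ᴿ x +ᴿ c *ᴿ z ^ᴿ k
      ≈⟨ eq ⟩
    1# ∎)

  unit : ∀ {x} → ¬ x ∈ᴿ M → ∃[ y ] y *ᴿ x ≈ 1#
  unit {x} x∉M with unit-modulo x∉M r
  ... | y , c , eq = y , (begin
    y *ᴿ x                   ≈⟨ R.+-identityʳ _ ⟨
    y *ᴿ x +ᴿ 0#             ≈⟨ R.+-congˡ (R.zeroʳ c) ⟨
    y *ᴿ x +ᴿ c *ᴿ 0#        ≈⟨ R.+-congˡ (R.*-congˡ vanishes) ⟨
    y *ᴿ x +ᴿ c *ᴿ z ^ᴿ r    ≈⟨ eq ⟩
    1#                       ∎)

  -- Expansions in base z and the orders of the ring and its maximal ideal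

  open Inverse residue using () renaming (to to digit; from to rep; to-cong to digit-cong;
    strictlyInverseˡ to digit-rep; strictlyInverseʳ to rep-digit)

  digit-step : ∀ x → ∃[ x′ ] x ≈ rep (digit x) +ᴿ x′ *ᴿ z
  digit-step x with rep-digit x
  ... | c , cz≈ = -ᴿ c , (begin
    x                                              ≈⟨ R.+-identityˡ x ⟨
    0# +ᴿ x                                        ≈⟨ R.+-congʳ (R.-‿inverseʳ (c *ᴿ z)) ⟨
    (c *ᴿ z -ᴿ c *ᴿ z) +ᴿ x                        ≈⟨ R.+-congʳ (R.+-congʳ cz≈) ⟩
    ((rep (digit x) -ᴿ x) -ᴿ c *ᴿ z) +ᴿ x
      ≈⟨ solve 4 (λ d nx nc x → ((d :+ nx) :+ nc) :+ x := d :+ nc :+ (x :+ nx)) R.refl (rep (digit x)) (-ᴿ x) (-ᴿ (c *ᴿ z)) x ⟩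
    (rep (digit x) -ᴿ c *ᴿ z) +ᴿ (x -ᴿ x)          ≈⟨ R.+-congˡ (R.-‿inverseʳ x) ⟩
    (rep (digit x) -ᴿ c *ᴿ z) +ᴿ 0#                ≈⟨ R.+-identityʳ _ ⟩
    rep (digit x) -ᴿ c *ᴿ z                        ≈⟨ R.+-congˡ (RingProperties.-‿distribˡ-* ring c z) ⟩
    rep (digit x) +ᴿ (-ᴿ c) *ᴿ z                   ∎)

  -- Horner's scheme with the lowest digit first; `remQuot` splits an index into that digit and the
  -- index of the remaining ones.
  value : ∀ k → Fin (q ^ k) → Carrier
  value zero    _ = 0#
  value (suc k) i = rep (proj₁ (remQuot {q} (q ^ k) i)) +ᴿ value k (proj₂ (remQuot {q} (q ^ k) i)) *ᴿ z

  expansion : ∀ k x → ∃[ i ] ∃[ y ] x ≈ value k i +ᴿ y *ᴿ z ^ᴿ k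
  expansion zero x = zero , x , solve 1 (λ x → x := con 0 :+ x :* con 1) R.refl x
  expansion (suc k) x with digit-step x
  ... | x′ , x≈ with expansion k x′
  ...   | i , y , x′≈ = combine (digit x) i , y , (begin
    x                                                     ≈⟨ x≈ ⟩
    rep (digit x) +ᴿ x′ *ᴿ z                              ≈⟨ R.+-congˡ (R.*-congʳ x′≈) ⟩
    rep (digit x) +ᴿ (value k i +ᴿ y *ᴿ z ^ᴿ k) *ᴿ z
      ≈⟨ solve 5 (λ d v y w z → d :+ (v :+ y :* w) :* z := (d :+ v :* z) :+ y :* (z :* w)) R.refl (rep (digit x)) (value k i) y (z ^ᴿ k) z ⟩
    (rep (digit x) +ᴿ value k i *ᴿ z) +ᴿ y *ᴿ (z *ᴿ z ^ᴿ k)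
      ≡⟨ cong (λ (d , j) → (rep d +ᴿ value k j *ᴿ z) +ᴿ y *ᴿ (z *ᴿ z ^ᴿ k)) (remQuot-combine (digit x) i) ⟨
    value (suc k) (combine (digit x) i) +ᴿ y *ᴿ z ^ᴿ suc k ∎)

  z^j≉0 : ∀ j → j < r → ¬ z ^ᴿ j ≈ 0#
  -- `least` speaks of positive exponents only; for exponent 0 the properness of `M` excludes 1 ≈ 0.
  z^j≉0 zero    _   1≈0   = 1∉M (∈ᴿ-resp (R.sym 1≈0) 0∈)
  z^j≉0 (suc j) j<r z^j≈0 = ℕ.<⇒≱ j<r (least (suc j) (s≤s z≤n) z^j≈0)

  cancel-digit : ∀ j {x v v′} → z ^ᴿ j *ᴿ (x +ᴿ v *ᴿ z) ≈ z ^ᴿ j *ᴿ (x +ᴿ v′ *ᴿ z) →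
                 z ^ᴿ suc j *ᴿ v ≈ z ^ᴿ suc j *ᴿ v′
  cancel-digit j {x} {v} {v′} eq = +-cancelˡ (z ^ᴿ j *ᴿ x) _ _ (begin
    z ^ᴿ j *ᴿ x +ᴿ z ^ᴿ suc j *ᴿ v     ≈⟨ split v ⟨
    z ^ᴿ j *ᴿ (x +ᴿ v *ᴿ z)            ≈⟨ eq ⟩
    z ^ᴿ j *ᴿ (x +ᴿ v′ *ᴿ z)           ≈⟨ split v′ ⟩
    z ^ᴿ j *ᴿ x +ᴿ z ^ᴿ suc j *ᴿ v′    ∎)
    where
    split : ∀ v → z ^ᴿ j *ᴿ (x +ᴿ v *ᴿ z) ≈ z ^ᴿ j *ᴿ x +ᴿ z ^ᴿ suc j *ᴿ v
    split v = solve 4 (λ w x v z → w :* (x :+ v :* z) := w :* x :+ (z :* w) :* v) R.refl (z ^ᴿ j) x v z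

  -- The difference of the two expansions is a unit annihilated by z ^ j.
  distinct-digits : ∀ j {d d′ v v′} → d ≢ d′ →
                    z ^ᴿ j *ᴿ (rep d +ᴿ v *ᴿ z) ≈ z ^ᴿ j *ᴿ (rep d′ +ᴿ v′ *ᴿ z) → z ^ᴿ j ≈ 0#
  distinct-digits j {d} {d′} {v} {v′} d≢d′ eq = begin
    z ^ᴿ j                 ≈⟨ R.*-identityʳ _ ⟨
    z ^ᴿ j *ᴿ 1#           ≈⟨ R.*-congˡ (proj₂ (unit w∉M)) ⟨
    z ^ᴿ j *ᴿ (y *ᴿ w)     ≈⟨ solve 3 (λ p y w → p :* (y :* w) := y :* (p :* w)) R.refl (z ^ᴿ j) y w ⟩
    y *ᴿ (z ^ᴿ j *ᴿ w)     ≈⟨ R.*-congˡ z^j*w≈0 ⟩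
    y *ᴿ 0#                ≈⟨ R.zeroʳ y ⟩
    0#                     ∎
    where
    f w : Carrier
    f = v +ᴿ -ᴿ v′
    w = (rep d -ᴿ rep d′) +ᴿ f *ᴿ z
    w∉M : ¬ w ∈ᴿ M
    w∉M w∈M with M⇒∣ w∈M
    ... | c , cz≈w = d≢d′ (trans (sym (digit-rep d)) (trans (digit-cong (c +ᴿ -ᴿ f , (begin
      (c +ᴿ -ᴿ f) *ᴿ z                                  ≈⟨ R.distribʳ z c (-ᴿ f) ⟩
      c *ᴿ z +ᴿ (-ᴿ f) *ᴿ z                             ≈⟨ R.+-congʳ cz≈w ⟩
      ((rep d -ᴿ rep d′) +ᴿ f *ᴿ z) +ᴿ (-ᴿ f) *ᴿ z
        ≈⟨ solve 4 (λ D f nf z → (D :+ f :* z) :+ nf :* z := D :+ (f :+ nf) :* z) R.refl (rep d -ᴿ rep d′) f (-ᴿ f) z ⟩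
      (rep d -ᴿ rep d′) +ᴿ (f -ᴿ f) *ᴿ z                ≈⟨ R.+-congˡ (R.trans (R.*-congʳ (R.-‿inverseʳ f)) (R.zeroˡ z)) ⟩
      (rep d -ᴿ rep d′) +ᴿ 0#                           ≈⟨ R.+-identityʳ _ ⟩
      rep d -ᴿ rep d′                                   ∎))) (digit-rep d′)))
    X X′ : Carrier
    X  = rep d +ᴿ v *ᴿ z
    X′ = rep d′ +ᴿ v′ *ᴿ z
    X′+w≈X : X′ +ᴿ w ≈ X
    X′+w≈X = begin
      X′ +ᴿ w
        ≈⟨ solve 7 (λ d v d′ v′ nd′ nv′ z → (d′ :+ v′ :* z) :+ ((d :+ nd′) :+ (v :+ nv′) :* z)
             := (d :+ v :* z) :+ ((d′ :+ nd′) :+ (v′ :+ nv′) :* z)) R.refl (rep d) v (rep d′) v′ (-ᴿ rep d′) (-ᴿ v′) z ⟩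
      X +ᴿ ((rep d′ -ᴿ rep d′) +ᴿ (v′ -ᴿ v′) *ᴿ z)
        ≈⟨ R.+-congˡ (R.+-cong (R.-‿inverseʳ (rep d′)) (R.trans (R.*-congʳ (R.-‿inverseʳ v′)) (R.zeroˡ z))) ⟩
      X +ᴿ (0# +ᴿ 0#)
        ≈⟨ solve 1 (λ x → x :+ (con 0 :+ con 0) := x) R.refl X ⟩
      X ∎
    z^j*w≈0 : z ^ᴿ j *ᴿ w ≈ 0#
    z^j*w≈0 = +-cancelˡ (z ^ᴿ j *ᴿ X′) _ _ (begin
      z ^ᴿ j *ᴿ X′ +ᴿ z ^ᴿ j *ᴿ w   ≈⟨ R.distribˡ (z ^ᴿ j) X′ w ⟨
      z ^ᴿ j *ᴿ (X′ +ᴿ w)           ≈⟨ R.*-congˡ X′+w≈X ⟩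
      z ^ᴿ j *ᴿ X                   ≈⟨ eq ⟩
      z ^ᴿ j *ᴿ X′                  ≈⟨ R.+-identityʳ _ ⟨
      z ^ᴿ j *ᴿ X′ +ᴿ 0#            ∎)
    y : Carrier
    y = proj₁ (unit w∉M)

  -- Since z cannot be cancelled, the claim carries the factor z^j: once the lowest digits agree,
  -- the z in front of the remaining ones is absorbed into it, and k + j stays r. Differing digits
  -- would give z^j ≈ 0 with j < r.
  value-injective : ∀ k j → k + j ≡ r → ∀ i i′ → z ^ᴿ j *ᴿ value k i ≈ z ^ᴿ j *ᴿ value k i′ → i ≡ i′
  value-injective zero    j _     zero zero _ = refl
  value-injective (suc k) j k+j≡r i i′ eq with proj₁ (remQuot {q} (q ^ k) i) ≟ proj₁ (remQuot {q} (q ^ k) i′)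
  ... | yes d≡d′ = trans (sym (combine-remQuot {q} (q ^ k) i)) (trans
    (cong₂ combine d≡d′ (value-injective k (suc j) (trans (ℕ.+-suc k j) k+j≡r) _ _
      (cancel-digit j (R.trans eq (R.reflexive (cong (λ d → z ^ᴿ j *ᴿ (rep d +ᴿ _ *ᴿ z)) (sym d≡d′)))))))
    (combine-remQuot {q} (q ^ k) i′))
  ... | no d≢d′ = contradiction (distinct-digits j d≢d′ eq) (z^j≉0 j (subst (suc j ≤_) k+j≡r (s≤s (ℕ.m≤n+m j k))))

  expansion-exact : ∀ x → ∃[ i ] x ≈ value r i
  expansion-exact x with expansion r x
  ... | i , y , x≈ = i , (begin
    x                              ≈⟨ x≈ ⟩
    value r i +ᴿ y *ᴿ z ^ᴿ r       ≈⟨ R.+-congˡ (R.*-congˡ vanishes) ⟩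
    value r i +ᴿ y *ᴿ 0#           ≈⟨ R.+-congˡ (R.zeroʳ y) ⟩
    value r i +ᴿ 0#                ≈⟨ R.+-identityʳ _ ⟩
    value r i                      ∎)

  order≡q^r : order ≡ q ^ r
  order≡q^r = ℕ.≤-antisym
    (injective⇒≤ {f = λ x → proj₁ (expansion-exact (element x))} λ {x} {y} eq →
      trans (sym (index-element x)) (trans (index-cong (R.trans (proj₂ (expansion-exact (element x)))
        (R.trans (R.reflexive (cong (value r) eq)) (R.sym (proj₂ (expansion-exact (element y))))))) (index-element y)))
    (injective⇒≤ {f = λ i → index (value r i)} λ {i} {i′} eq →
      value-injective r 0 (ℕ.+-identityʳ r) i i′ (R.*-congˡ (R.trans (R.sym (element-index _)) (R.trans (element-cong eq) (element-index _)))))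

  -- Multiplication by z kills everything in y beyond its first r - 1 digits, so these determine y
  -- z.
  ∣M∣≤q^[r∸1] : ∣ M ∣ ≤ q ^ (r ∸ 1)
  ∣M∣≤q^[r∸1] = ∣∣-covered M (λ i → index (value (r ∸ 1) i *ᴿ z)) covers
    where
    covers : ∀ {k} → k ∈ M → ∃[ i ] k ≡ index (value (r ∸ 1) i *ᴿ z)
    covers {k} k∈M with M⇒∣ (∈⇒element k∈M)
    ... | y , yz≈k with expansion (r ∸ 1) y
    ...   | i , w , y≈ = i , trans (sym (index-element k)) (index-cong (begin
      element k                                       ≈⟨ yz≈k ⟨
      y *ᴿ z                                          ≈⟨ R.*-congʳ y≈ ⟩
      (value (r ∸ 1) i +ᴿ w *ᴿ z ^ᴿ (r ∸ 1)) *ᴿ z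
        ≈⟨ solve 4 (λ v w p z → (v :+ w :* p) :* z := v :* z :+ w :* (z :* p)) R.refl (value (r ∸ 1) i) w (z ^ᴿ (r ∸ 1)) z ⟩
      value (r ∸ 1) i *ᴿ z +ᴿ w *ᴿ z ^ᴿ suc (r ∸ 1)   ≡⟨ cong (λ s → value (r ∸ 1) i *ᴿ z +ᴿ w *ᴿ z ^ᴿ s) (ℕ.m+[n∸m]≡n positive) ⟩
      value (r ∸ 1) i *ᴿ z +ᴿ w *ᴿ z ^ᴿ r             ≈⟨ R.+-congˡ (R.trans (R.*-congˡ vanishes) (R.zeroʳ w)) ⟩
      value (r ∸ 1) i *ᴿ z +ᴿ 0#                      ≈⟨ R.+-identityʳ _ ⟩
      value (r ∸ 1) i *ᴿ z                            ∎))

  -- If 2 ∈ M, then x ↦ x + 1 is a fixed-point-free involution of the residue field.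
  2∈M⇒2∣q : 1# +ᴿ 1# ∈ᴿ M → 2 ∣ℕ q
  2∈M⇒2∣q 2∈M = involution⇒even σ σσ σ≢
    where
    σ : Fin q → Fin q
    σ d = digit (rep d +ᴿ 1#)
    [x+y]-x≈y : ∀ x y → (x +ᴿ y) -ᴿ x ≈ y
    [x+y]-x≈y x y = begin
      (x +ᴿ y) -ᴿ x     ≈⟨ solve 3 (λ x y nx → (x :+ y) :+ nx := (x :+ nx) :+ y) R.refl x y (-ᴿ x) ⟩
      (x -ᴿ x) +ᴿ y     ≈⟨ R.+-congʳ (R.-‿inverseʳ x) ⟩
      0# +ᴿ y           ≈⟨ R.+-identityˡ y ⟩
      y                 ∎
    digit-shift : ∀ {x y m} → m ∈ᴿ M → x ≈ y +ᴿ m → digit x ≡ digit y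
    digit-shift {x} {y} {m} m∈M x≈ with M⇒∣ m∈M
    ... | c , cz≈m = digit-cong (c , (begin
      c *ᴿ z            ≈⟨ cz≈m ⟩
      m                 ≈⟨ [x+y]-x≈y y m ⟨
      (y +ᴿ m) -ᴿ y     ≈⟨ R.+-congʳ x≈ ⟨
      x -ᴿ y            ∎))
    σσ : ∀ d → σ (σ d) ≡ d
    σσ d with digit-step (rep d +ᴿ 1#)
    ... | x′ , eq = trans (sym (digit-shift (+-closed (∣⇒M (x′ , R.refl)) 0∈) lift)) (trans (digit-shift 2∈M (R.+-assoc (rep d) 1# 1#)) (digit-rep d))
      where
      lift : (rep d +ᴿ 1#) +ᴿ 1# ≈ (rep (σ d) +ᴿ 1#) +ᴿ (x′ *ᴿ z +ᴿ 0#)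
      lift = R.trans (R.+-congʳ eq)
        (solve 2 (λ s t → (s :+ t) :+ con 1 := (s :+ con 1) :+ (t :+ con 0)) R.refl (rep (σ d)) (x′ *ᴿ z))
    σ≢ : ∀ d → σ d ≢ d
    σ≢ d σd≡d with digit-step (rep d +ᴿ 1#)
    ... | x′ , eq = 1∉M (∣⇒M (x′ , +-cancelˡ (rep d) _ _ (begin
      rep d +ᴿ x′ *ᴿ z       ≡⟨ cong (λ e → rep e +ᴿ x′ *ᴿ z) σd≡d ⟨
      rep (σ d) +ᴿ x′ *ᴿ z   ≈⟨ eq ⟨
      rep d +ᴿ 1#            ∎)))

  -- The ring laws are pulled back along `element`, which is injective and, with operations defined
  -- through `index`, a homomorphism.
  oddLocalRing : ¬ 2 ∣ℕ q → OddLocalRing order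
  oddLocalRing 2∤q = record
    { _⊞_ = λ i j → index (element i +ᴿ element j)
    ; _⊠_ = λ i j → index (element i *ᴿ element j)
    ; ⊟_  = λ i → index (-ᴿ element i)
    ; 0R  = index 0#
    ; 1R  = index 1#
    ; isCommutativeRing = RingMonomorphism.isCommutativeRing element-mono R.isCommutativeRing
    ; N = M
    ; N-⊞ = λ i∈M j∈M → +-closed (∈⇒element i∈M) (∈⇒element j∈M)
    ; N-⊠ = λ i j∈M → *-closed (element i) (∈⇒element j∈M)
    ; invertible = λ {i} i∉M → let (y , yx≈1) = unit (λ x∈M → i∉M (subst (_∈ M) (index-element i) x∈M)) in
        index y , index-cong (R.trans (R.*-congʳ (element-index y)) yx≈1)
    ; 2∉N = λ 2∈M → 2∤q (2∈M⇒2∣q (∈ᴿ-resp (R.+-cong (element-index 1#) (element-index 1#)) 2∈M))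
    }
    where
    element-mono : IsRingMonomorphism _ R.rawRing element
    element-mono = record
      { isRingHomomorphism = record
        { isSemiringHomomorphism = record
          { isNearSemiringHomomorphism = record
            { +-isMonoidHomomorphism = record
              { isMagmaHomomorphism = record
                { isRelHomomorphism = record { cong = element-cong }
                ; homo = λ _ _ → element-index _
                }
              ; ε-homo = element-index _
              }
            ; *-homo = λ _ _ → element-index _
            }
          ; 1#-homo = element-index _
          }
        ; -‿homo = λ _ → element-index _
        }
      ; injective = λ {i} {j} eq → trans (sym (index-element i)) (trans (index-cong eq) (index-element j))
      }

-- The constant

fromℕ-* : ∀ m n → fromℕ (m * n) ≡ fromℕ m ℚ.* fromℕ n
fromℕ-* m n = ℚ.toℚᵘ-injective (begin
  ℚ.toℚᵘ (fromℕ (m * n))                            ≈⟨ ℚ.toℚᵘ-fromℚᵘ (ℚᵘ.mkℚᵘ (ℤ.+ (m * n)) 0) ⟩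
  ℚᵘ.mkℚᵘ (ℤ.+ (m * n)) 0                           ≡⟨ cong (λ i → ℚᵘ.mkℚᵘ i 0) (ℤ.pos-* m n) ⟩
  ℚᵘ.mkℚᵘ (ℤ.+ m) 0 ℚᵘ.* ℚᵘ.mkℚᵘ (ℤ.+ n) 0
    ≈⟨ ℚᵘ.*-cong (ℚ.toℚᵘ-fromℚᵘ (ℚᵘ.mkℚᵘ (ℤ.+ m) 0)) (ℚ.toℚᵘ-fromℚᵘ (ℚᵘ.mkℚᵘ (ℤ.+ n) 0)) ⟨
  ℚ.toℚᵘ (fromℕ m) ℚᵘ.* ℚ.toℚᵘ (fromℕ n)            ≈⟨ ℚ.toℚᵘ-homo-* (fromℕ m) (fromℕ n) ⟨
  ℚ.toℚᵘ (fromℕ m ℚ.* fromℕ n)                      ∎)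
  where open ℚᵘ.≃-Reasoning

fromℕ-mono-≤ : ∀ {m n} → m ≤ n → fromℕ m ℚ.≤ fromℕ n
fromℕ-mono-≤ {m} {n} m≤n = ℚ.toℚᵘ-cancel-≤ (begin
  ℚ.toℚᵘ (fromℕ m)     ≃⟨ ℚ.toℚᵘ-fromℚᵘ (ℚᵘ.mkℚᵘ (ℤ.+ m) 0) ⟩
  ℚᵘ.mkℚᵘ (ℤ.+ m) 0    ≤⟨ ℚᵘ.*≤* (ℤ.*-monoʳ-≤-nonNeg (ℤ.+ 1) (ℤ.+≤+ m≤n)) ⟩
  ℚᵘ.mkℚᵘ (ℤ.+ n) 0    ≃⟨ ℚ.toℚᵘ-fromℚᵘ (ℚᵘ.mkℚᵘ (ℤ.+ n) 0) ⟨
  ℚ.toℚᵘ (fromℕ n)     ∎)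
  where open ℚᵘ.≤-Reasoning

fromℕ-nonNeg : ∀ n → ℚ.NonNegative (fromℕ n)
fromℕ-nonNeg n = ℚ.nonNegative (fromℕ-mono-≤ {0} {n} z≤n)

fromℕ-pos : ∀ n → .{{NonZero n}} → ℚ.Positive (fromℕ n)
fromℕ-pos n {{n≢0}} = ℚ.positive (ℚ.<-≤-trans {0ℚ} {1ℚ} (ℚ.*<* (ℤ.+<+ (s≤s z≤n))) (fromℕ-mono-≤ {1} {n} (>-nonZero⁻¹ n {{n≢0}})))

-- The cubed inequality involves C³; this bound allows a rational C to be chosen without extracting
-- a cube root.
cube≤self : ∀ {C} → 0ℚ ℚ.< C → C ℚ.≤ 1ℚ → C ℚ.* C ℚ.* C ℚ.≤ C
cube≤self {C} 0<C C≤1 = begin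
  C ℚ.* C ℚ.* C      ≤⟨ ℚ.*-monoʳ-≤-nonNeg C (ℚ.*-monoʳ-≤-nonNeg C C≤1) ⟩
  1ℚ ℚ.* C ℚ.* C     ≡⟨ cong (ℚ._* C) (ℚ.*-identityˡ C) ⟩
  C ℚ.* C            ≤⟨ ℚ.*-monoʳ-≤-nonNeg C C≤1 ⟩
  1ℚ ℚ.* C           ≡⟨ ℚ.*-identityˡ C ⟩
  C                  ∎
  where
  open ℚ.≤-Reasoning
  instance
    C≥0 : ℚ.NonNegative C
    C≥0 = ℚ.nonNegative (ℚ.<⇒≤ 0<C)

1/16ℚ : ℚ
1/16ℚ = ℤ.+ 1 ℚ./ 16

module Constant (c : ℚ) (c>0 : c ℚ.> 0ℚ) where

  -- The two entries serve the two alternatives of the dichotomy: c/16 where 16 and the hypothesis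
  -- enter, ½ where the factor is 2. The cap ½ also gives C ≤ 1, hence C³ ≤ C.
  C : ℚ
  C = (c ℚ.* 1/16ℚ) ℚ.⊓ ½

  C≤c/16 : C ℚ.≤ c ℚ.* 1/16ℚ
  C≤c/16 = ℚ.p⊓q≤p (c ℚ.* 1/16ℚ) ½

  C≤½ : C ℚ.≤ ½
  C≤½ = ℚ.p⊓q≤q (c ℚ.* 1/16ℚ) ½

  C>0 : C ℚ.> 0ℚ
  C>0 with ℚ.⊓-sel (c ℚ.* 1/16ℚ) ½
  ... | inj₁ C≡c/16 = subst (ℚ._> 0ℚ) (sym C≡c/16)
    (ℚ.positive⁻¹ (c ℚ.* 1/16ℚ) {{ℚ.pos*pos⇒pos c {{ℚ.positive c>0}} 1/16ℚ}})
  ... | inj₂ C≡½    = subst (ℚ._> 0ℚ) (sym C≡½) (ℚ.positive⁻¹ ½)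

  C³≤C : C ℚ.* C ℚ.* C ℚ.≤ C
  C³≤C = cube≤self C>0 (ℚ.≤-trans C≤½ ½≤1)
    where
    ½≤1 : ½ ℚ.≤ 1ℚ
    ½≤1 = ℚ.*≤* (ℤ.+≤+ (s≤s z≤n))

  C³X≤DX : ∀ {D} → C ℚ.≤ D → ∀ X → C ℚ.* C ℚ.* C ℚ.* fromℕ X ℚ.≤ D ℚ.* fromℕ X
  C³X≤DX C≤D X = ℚ.*-monoʳ-≤-nonNeg (fromℕ X) {{fromℕ-nonNeg X}} (ℚ.≤-trans C³≤C C≤D)

  module _ {n a s t : ℕ} (a≤s : a ≤ s) where

    private
      μ : ℕ
      μ = s ⊔ t
      s≤μ : s ≤ μ
      s≤μ = ℕ.m≤m⊔n s t
      t≤μ : t ≤ μ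
      t≤μ = ℕ.m≤n⊔m s t

    -- Multiplying by a ≤ s supplies the third factor: n a² ≤ 2 s² t ≤ 2 μ³.
    many-sums : n * a ≤ 2 * (s * t) → C · (n * a ^ 2) ^⅓≤ μ
    many-sums na≤2st = begin
      C ℚ.* C ℚ.* C ℚ.* fromℕ (n * a ^ 2)    ≤⟨ C³X≤DX C≤½ (n * a ^ 2) ⟩
      ½ ℚ.* fromℕ (n * a ^ 2)                ≤⟨ ℚ.*-monoˡ-≤-nonNeg ½ (fromℕ-mono-≤ na²≤2μ³) ⟩
      ½ ℚ.* fromℕ (2 * μ ^ 3)                ≡⟨ cong (½ ℚ.*_) (fromℕ-* 2 (μ ^ 3)) ⟩
      ½ ℚ.* (fromℕ 2 ℚ.* fromℕ (μ ^ 3))      ≡⟨ ℚ.*-assoc ½ (fromℕ 2) (fromℕ (μ ^ 3)) ⟨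
      1ℚ ℚ.* fromℕ (μ ^ 3)                   ≡⟨ ℚ.*-identityˡ _ ⟩
      fromℕ (μ ^ 3)                          ∎
      where
      open ℚ.≤-Reasoning
      e₁ : ∀ n a → n * (a * (a * 1)) ≡ n * a * a
      e₁ = solve-∀
      e₂ : ∀ m → 2 * (m * m) * m ≡ 2 * (m * (m * (m * 1)))
      e₂ = solve-∀
      na²≤2μ³ : n * a ^ 2 ≤ 2 * μ ^ 3
      na²≤2μ³ = ℕ.≤-trans (ℕ.≤-reflexive (e₁ n a)) (ℕ.≤-trans
        (ℕ.*-mono-≤ (ℕ.≤-trans na≤2st (ℕ.*-monoʳ-≤ 2 (ℕ.*-mono-≤ s≤μ t≤μ))) (ℕ.≤-trans a≤s s≤μ))
        (ℕ.≤-reflexive (e₂ μ)))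

    -- Both hypotheses bound s a⁴: the second, times a², gives c n a² · nk ≤ s a⁴, and the first,
    -- times s, gives s a⁴ ≤ 16 μ³ · nk. Cancelling nk leaves c n a² ≤ 16 μ³.
    few-sums : ∀ {k} → .{{NonZero (n * k)}} → a * a * (a * a) ≤ 16 * (n * k * (s * t)) →
               fromℕ (s * a ^ 2) ℚ.≥ c ℚ.* fromℕ (n * (n * k)) → C · (n * a ^ 2) ^⅓≤ μ
    few-sums {k} a⁴≤ sa²≥ = begin
      C ℚ.* C ℚ.* C ℚ.* fromℕ (n * a ^ 2)           ≤⟨ C³X≤DX C≤c/16 (n * a ^ 2) ⟩
      c ℚ.* 1/16ℚ ℚ.* fromℕ (n * a ^ 2)             ≡⟨ cong (ℚ._* fromℕ (n * a ^ 2)) (ℚ.*-comm c 1/16ℚ) ⟩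
      1/16ℚ ℚ.* c ℚ.* fromℕ (n * a ^ 2)             ≡⟨ ℚ.*-assoc 1/16ℚ c (fromℕ (n * a ^ 2)) ⟩
      1/16ℚ ℚ.* (c ℚ.* fromℕ (n * a ^ 2))           ≤⟨ ℚ.*-monoˡ-≤-nonNeg 1/16ℚ cna²≤16μ³ ⟩
      1/16ℚ ℚ.* fromℕ (16 * μ ^ 3)                  ≡⟨ cong (1/16ℚ ℚ.*_) (fromℕ-* 16 (μ ^ 3)) ⟩
      1/16ℚ ℚ.* (fromℕ 16 ℚ.* fromℕ (μ ^ 3))        ≡⟨ ℚ.*-assoc 1/16ℚ (fromℕ 16) (fromℕ (μ ^ 3)) ⟨
      1ℚ ℚ.* fromℕ (μ ^ 3)                          ≡⟨ ℚ.*-identityˡ _ ⟩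
      fromℕ (μ ^ 3)                                 ∎
      where
      open ℚ.≤-Reasoning
      e₁ : ∀ n a k → n * (a * (a * 1)) * (n * k) ≡ n * (n * k) * (a * (a * 1))
      e₁ = solve-∀
      e₂ : ∀ s a → s * (a * (a * 1)) * (a * (a * 1)) ≡ s * (a * a * (a * a))
      e₂ = solve-∀
      e₃ : ∀ m n k → m * (16 * (n * k * (m * m))) ≡ 16 * (m * (m * (m * 1))) * (n * k)
      e₃ = solve-∀
      sa⁴≤ : s * a ^ 2 * a ^ 2 ≤ 16 * μ ^ 3 * (n * k)
      sa⁴≤ = ℕ.≤-trans (ℕ.≤-reflexive (e₂ s a)) (ℕ.≤-trans
        (ℕ.*-mono-≤ s≤μ (ℕ.≤-trans a⁴≤ (ℕ.*-monoʳ-≤ 16 (ℕ.*-monoʳ-≤ (n * k) (ℕ.*-mono-≤ s≤μ t≤μ)))))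
        (ℕ.≤-reflexive (e₃ μ n k)))
      cna²≤16μ³ : c ℚ.* fromℕ (n * a ^ 2) ℚ.≤ fromℕ (16 * μ ^ 3)
      cna²≤16μ³ = ℚ.*-cancelʳ-≤-pos (fromℕ (n * k)) {{fromℕ-pos (n * k)}} (begin
        c ℚ.* fromℕ (n * a ^ 2) ℚ.* fromℕ (n * k)        ≡⟨ ℚ.*-assoc c (fromℕ (n * a ^ 2)) (fromℕ (n * k)) ⟩
        c ℚ.* (fromℕ (n * a ^ 2) ℚ.* fromℕ (n * k))      ≡⟨ cong (c ℚ.*_) (fromℕ-* (n * a ^ 2) (n * k)) ⟨
        c ℚ.* fromℕ (n * a ^ 2 * (n * k))                ≡⟨ cong (λ x → c ℚ.* fromℕ x) (e₁ n a k) ⟩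
        c ℚ.* fromℕ (n * (n * k) * a ^ 2)                ≡⟨ cong (c ℚ.*_) (fromℕ-* (n * (n * k)) (a ^ 2)) ⟩
        c ℚ.* (fromℕ (n * (n * k)) ℚ.* fromℕ (a ^ 2))    ≡⟨ ℚ.*-assoc c (fromℕ (n * (n * k))) (fromℕ (a ^ 2)) ⟨
        c ℚ.* fromℕ (n * (n * k)) ℚ.* fromℕ (a ^ 2)      ≤⟨ ℚ.*-monoʳ-≤-nonNeg (fromℕ (a ^ 2)) {{fromℕ-nonNeg (a ^ 2)}} sa²≥ ⟩
        fromℕ (s * a ^ 2) ℚ.* fromℕ (a ^ 2)              ≡⟨ fromℕ-* (s * a ^ 2) (a ^ 2) ⟨
        fromℕ (s * a ^ 2 * a ^ 2)                        ≤⟨ fromℕ-mono-≤ sa⁴≤ ⟩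
        fromℕ (16 * μ ^ 3 * (n * k))                     ≡⟨ fromℕ-* (16 * μ ^ 3) (n * k) ⟩
        fromℕ (16 * μ ^ 3) ℚ.* fromℕ (n * k)             ∎)

-- Puts the threshold into the form n · (n k) of `few-sums`, with n = q^r and k = q^(r-1).
q^[3r∸1] : ∀ q {r} → 0 < r → q ^ (3 * r ∸ 1) ≡ q ^ r * (q ^ r * q ^ (r ∸ 1))
q^[3r∸1] q {suc r} _ = begin
  q ^ (r + (suc r + (suc r + 0)))           ≡⟨ cong (q ^_) (e r) ⟩
  q ^ (suc r + (suc r + r))                 ≡⟨ ℕ.^-distribˡ-+-* q (suc r) (suc r + r) ⟩
  q ^ suc r * q ^ (suc r + r)               ≡⟨ cong (q ^ suc r *_) (ℕ.^-distribˡ-+-* q (suc r) r) ⟩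
  q ^ suc r * (q ^ suc r * q ^ r)           ∎
  where
  open ≡-Reasoning
  e : ∀ r → r + (suc r + (suc r + 0)) ≡ suc r + (suc r + r)
  e = solve-∀

-- Sumsets and square sets, and the final assembly

module _ {a ℓ} (V : FiniteValuationRing a ℓ) where
  open FiniteValuationRing V hiding (_∈_)
  open CommutativeRing commutativeRing using () renaming (_+_ to _+ᴿ_; _*_ to _*ᴿ_)
  open Inverse size using () renaming (to to index; from to element)

  ⊕⁺ : ∀ {A B i j} → i ∈ A → j ∈ B → index (element i +ᴿ element j) ∈ A ⊕ B
  ⊕⁺ {A} {B} {i} {j} i∈A j∈B = ∈-comprehension⁺
    (λ k → any? λ i → any? λ j → (i ∈? A) ×-dec (j ∈? B) ×-dec (k ≟ index (element i +ᴿ element j)))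
    (i , j , i∈A , j∈B , refl)

  squares⁺ : ∀ {A i} → i ∈ A → index (element i *ᴿ element i) ∈ squares A
  squares⁺ {A} {i} i∈A = ∈-comprehension⁺
    (λ k → any? λ i → (i ∈? A) ×-dec (k ≟ index (element i *ᴿ element i)))
    (i , i∈A , refl)

theorem1p5 : ∀ {a ℓ} (c : ℚ) → c ℚ.> 0ℚ →
    ∃[ C ] C ℚ.> 0ℚ ×
    ((R : FiniteValuationRing a ℓ) → let open FiniteValuationRing R in
    ∀ (z : Carrier) (q r : ℕ) →
    IsUniformizer z → HasSize (residueField z) q → IsNilpotencyIndex z r →
    OddPrimePower q →
    (A : Subset order) →
    ∣ A ∣ ≥ 2 * q ^ (r ∸ 1) →
    fromℕ (∣ A ⊕ A ∣ * ∣ A ∣ ^ 2) ℚ.≥ c ℚ.* fromℕ (q ^ (3 * r ∸ 1)) →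
    C · (q ^ r * ∣ A ∣ ^ 2) ^⅓≤ (∣ A ⊕ A ∣ ⊔ ∣ squares A ⊕ squares A ∣))
theorem1p5 {a} {ℓ} c c>0 = C , C>0 , main
  where
  open Constant c c>0
  main : (R : FiniteValuationRing a ℓ) → let open FiniteValuationRing R in
    ∀ (z : Carrier) (q r : ℕ) →
    IsUniformizer z → HasSize (residueField z) q → IsNilpotencyIndex z r →
    OddPrimePower q →
    (A : Subset order) →
    ∣ A ∣ ≥ 2 * q ^ (r ∸ 1) →
    fromℕ (∣ A ⊕ A ∣ * ∣ A ∣ ^ 2) ℚ.≥ c ℚ.* fromℕ (q ^ (3 * r ∸ 1)) →
    C · (q ^ r * ∣ A ∣ ^ 2) ^⅓≤ (∣ A ⊕ A ∣ ⊔ ∣ squares A ⊕ squares A ∣)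
  main R z q r uniformizer residue nilpotency q-odd A ∣A∣≥ ∣A+A∣∣A∣²≥ =
    conclude (sum-product-dichotomy (⊕⁺ R) (squares⁺ R) (⊕⁺ R) 0<∣A∣ 2∣M∣≤∣A∣)
    where
    open FiniteValuationRing R using (order; module IsNilpotencyIndex; _⊕_; squares)
    open Structure R uniformizer residue nilpotency
    open SquareSums (oddLocalRing (2∤oddPrimePower q-odd))
    instance
      q≢0 : NonZero q
      q≢0 = >-nonZero (oddPrimePower>0 q-odd)
      q^r*q^[r∸1]≢0 : NonZero (q ^ r * q ^ (r ∸ 1))
      q^r*q^[r∸1]≢0 = ℕ.m*n≢0 _ _ {{ℕ.m^n≢0 q r}} {{ℕ.m^n≢0 q (r ∸ 1)}}
    0<∣A∣ : 0 < ∣ A ∣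
    0<∣A∣ = ℕ.≤-trans (ℕ.≤-trans (ℕ.m^n>0 q (r ∸ 1)) (ℕ.m≤m+n _ _)) ∣A∣≥
    2∣M∣≤∣A∣ : 2 * ∣ M ∣ ≤ ∣ A ∣
    2∣M∣≤∣A∣ = ℕ.≤-trans (ℕ.*-monoʳ-≤ 2 ∣M∣≤q^[r∸1]) ∣A∣≥
    P : ℕ
    P = ∣ A ⊕ A ∣ * ∣ squares A ⊕ squares A ∣
    conclude : order * ∣ A ∣ ≤ 2 * P ⊎ ∣ A ∣ * ∣ A ∣ * (∣ A ∣ * ∣ A ∣) ≤ 16 * (order * ∣ M ∣ * P) →
               C · (q ^ r * ∣ A ∣ ^ 2) ^⅓≤ (∣ A ⊕ A ∣ ⊔ ∣ squares A ⊕ squares A ∣)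
    conclude (inj₁ many) = many-sums {n = q ^ r} (∣A∣≤∣A+A∣ (⊕⁺ R))
      (subst (λ n → n * ∣ A ∣ ≤ 2 * P) order≡q^r many)
    -- `few` has |M| on its larger side, so the upper bound q^(r-1) may replace it and match the
    -- power of q in the hypothesis.
    conclude (inj₂ few) = few-sums {n = q ^ r} (∣A∣≤∣A+A∣ (⊕⁺ R)) {k = q ^ (r ∸ 1)}
      (ℕ.≤-trans few (ℕ.*-monoʳ-≤ 16 (ℕ.*-monoˡ-≤ P (ℕ.*-mono-≤ (ℕ.≤-reflexive order≡q^r) ∣M∣≤q^[r∸1]))))
      (subst (λ x → fromℕ (∣ A ⊕ A ∣ * ∣ A ∣ ^ 2) ℚ.≥ c ℚ.* fromℕ x) (q^[3r∸1] q (IsNilpotencyIndex.positive nilpotency)) ∣A+A∣∣A∣²≥)
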